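{- (In $\mathsf{ZF}$.) Assume $\mathsf{AC}_\omega(\mathbb{R})$. Then for every set $X$, $\mathsf{DC}(X)$ implies $\mathsf{AC}_\omega(X)$.
   Context: Work in $\mathsf{ZF}$ (no choice). For a set $X$: $\mathsf{DC}(X)$ is the statement that for every nonempty binary relation $R \subseteq X \times X$ which is total on $X$ (i.e. for every $x \in X$ there is $y \in X$ with $x \mathrel{R} y$) there is a sequence $(x_n)_{n\in\omega}$ of elements of $X$ with $x_n \mathrel{R} x_{n+1}$ for all $n$. $\mathsf{AC}_\omega(X)$ is the statement that for every sequence $(A_n)_{n \in \omega}$ of nonempty subsets of $X$ there is a sequence $(a_n)_{n\in\omega}$ with $a_n \in A_n$ for all $n$. -}

-- Being a theorem of ZF is rendered as holding in every model of ZF: a type V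
-- with a binary relation ∈, the equality of the language being _≡_ on V.  The
-- two axiom schemes range over first-order formulas only.  This matters: ∃ is
-- interpreted by Σ, so a scheme over arbitrary predicates V → Set would turn
-- the choice functions of type theory into sets and make choice hold outright.
-- For the same reason relations, functions, sequences and sets of reals below
-- are always elements of V.
module Defs where

open import Level using (Level)
open import Algebra.Core using (Op₁; Op₂)
open import Algebra.Structures using (IsCommutativeRing)
open import Data.Fin.Base using (Fin)
open import Data.Nat.Base using (ℕ; suc)
open import Data.Product.Base using (∃; ∃-syntax; _×_; proj₁; proj₂)
open import Data.Product using (∃!)
open import Data.Sum.Base using (_⊎_)
open import Data.Vec.Base using (Vec; _∷_; lookup)
open import Function.Bundles using (_⇔_)
open import Relation.Binary.Core using (Rel)
open import Relation.Binary.PropositionalEquality.Core using (_≡_)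
open import Relation.Binary.Structures using (IsStrictTotalOrder)
open import Relation.Nullary using (¬_; Dec)

private variable
  ℓ : Level
  n : ℕ

-- Formulas of the language {∈, =} with n free variables (de Bruijn indices).
data Formula (n : ℕ) : Set where
  _∈′_ _≡′_      : Fin n → Fin n → Formula n
  ¬′_            : Formula n → Formula n
  _∧′_ _∨′_ _⇒′_ : Formula n → Formula n → Formula n
  ∀′_ ∃′_        : Formula (suc n) → Formula n

module Semantics {V : Set ℓ} (_∈_ : Rel V ℓ) where

  infix 3 _⊨_

  _⊨_ : Vec V n → Formula n → Set ℓ
  ρ ⊨ (i ∈′ j) = lookup ρ i ∈ lookup ρ j
  ρ ⊨ (i ≡′ j) = lookup ρ i ≡ lookup ρ j
  ρ ⊨ (¬′ φ)   = ¬ (ρ ⊨ φ)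
  ρ ⊨ (φ ∧′ ψ) = (ρ ⊨ φ) × (ρ ⊨ ψ)
  ρ ⊨ (φ ∨′ ψ) = (ρ ⊨ φ) ⊎ (ρ ⊨ ψ)
  ρ ⊨ (φ ⇒′ ψ) = (ρ ⊨ φ) → (ρ ⊨ ψ)
  ρ ⊨ (∀′ φ)   = ∀ x → x ∷ ρ ⊨ φ
  ρ ⊨ (∃′ φ)   = ∃[ x ] (x ∷ ρ ⊨ φ)

record ZF (V : Set ℓ) (_∈_ : Rel V ℓ) : Set ℓ where
  open Semantics _∈_ public

  infix 4 _⊆_

  _⊆_ : Rel V ℓ
  x ⊆ y = ∀ z → z ∈ x → z ∈ y

  Nonempty : V → Set ℓ
  Nonempty x = ∃[ z ] z ∈ x

  field
    -- ZF is a theory in classical logic, whereas Agda's logic is not classical.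
    excludedMiddle : (φ : Formula n) (ρ : Vec V n) → Dec (ρ ⊨ φ)

    extensionality : ∀ x y → (∀ z → z ∈ x ⇔ z ∈ y) → x ≡ y
    foundation     : ∀ x → Nonempty x → ∃[ y ] (y ∈ x × (∀ z → z ∈ x → ¬ z ∈ y))
    pairing        : ∀ x y → ∃[ p ] (∀ z → z ∈ p ⇔ (z ≡ x ⊎ z ≡ y))
    union          : ∀ x → ∃[ u ] (∀ z → z ∈ u ⇔ (∃[ y ] (y ∈ x × z ∈ y)))
    powerSet       : ∀ x → ∃[ p ] (∀ z → z ∈ p ⇔ z ⊆ x)

    separation     : (φ : Formula (suc n)) (ρ : Vec V n) → ∀ x →
                     ∃[ s ] (∀ z → z ∈ s ⇔ (z ∈ x × (z ∷ ρ ⊨ φ)))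
    replacement    : (φ : Formula (suc (suc n))) (ρ : Vec V n) → ∀ x →
                     (∀ a → a ∈ x → ∀ b c → b ∷ a ∷ ρ ⊨ φ → c ∷ a ∷ ρ ⊨ φ → b ≡ c) →
                     ∃[ r ] (∀ b → b ∈ r ⇔ (∃[ a ] (a ∈ x × (b ∷ a ∷ ρ ⊨ φ))))

  ⟅_,_⟆ : V → V → V
  ⟅ x , y ⟆ = proj₁ (pairing x y)

  ⟨_,_⟩ : V → V → V
  ⟨ x , y ⟩ = ⟅ ⟅ x , x ⟆ , ⟅ x , y ⟆ ⟆

  ⋃ : V → V
  ⋃ x = proj₁ (union x)

  𝒫 : V → V
  𝒫 x = proj₁ (powerSet x)

  succ : V → V
  succ x = ⋃ ⟅ x , ⟅ x , x ⟆ ⟆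

  Inductive : V → Set ℓ
  Inductive i = (∃[ e ] (¬ Nonempty e × e ∈ i)) × (∀ x → x ∈ i → succ x ∈ i)

  field
    infinity : ∃[ i ] Inductive i

module Notions {V : Set ℓ} {_∈_ : Rel V ℓ} (zf : ZF V _∈_) where
  open ZF zf

  Isω : V → Set ℓ
  Isω w = Inductive w × (∀ i → Inductive i → w ⊆ i)

  IsRelation : V → V → V → Set ℓ
  IsRelation r a b = ∀ p → p ∈ r → ∃[ x ] ∃[ y ] (x ∈ a × y ∈ b × p ≡ ⟨ x , y ⟩)

  IsFunction : V → V → V → Set ℓ
  IsFunction f a b =
    IsRelation f a b × (∀ x → x ∈ a → ∃! _≡_ (λ y → ⟨ x , y ⟩ ∈ f))

  DC : (ω X : V) → Set ℓ
  DC ω X =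
    ∀ R → IsRelation R X X → Nonempty R →
    (∀ x → x ∈ X → ∃[ y ] (y ∈ X × ⟨ x , y ⟩ ∈ R)) →
    ∃[ f ] (IsFunction f ω X ×
            (∀ n x y → ⟨ n , x ⟩ ∈ f → ⟨ succ n , y ⟩ ∈ f → ⟨ x , y ⟩ ∈ R))

  ACω : (ω X : V) → Set ℓ
  ACω ω X =
    ∀ A → IsFunction A ω (𝒫 X) →
    (∀ n Aₙ → ⟨ n , Aₙ ⟩ ∈ A → Nonempty Aₙ) →
    ∃[ f ] (IsFunction f ω X ×
            (∀ n Aₙ aₙ → ⟨ n , Aₙ ⟩ ∈ A → ⟨ n , aₙ ⟩ ∈ f → aₙ ∈ Aₙ))

  El : V → Set ℓ
  El a = ∃[ x ] x ∈ a

  infix 4 _≈_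

  _≈_ : {a : V} → Rel (El a) ℓ
  x ≈ y = proj₁ x ≡ proj₁ y

  -- g is (the graph of) a function a × a → a.
  record IsOperation (g a : V) : Set ℓ where
    field
      graph : ∀ p → p ∈ g →
              ∃[ x ] ∃[ y ] ∃[ z ] (x ∈ a × y ∈ a × z ∈ a × p ≡ ⟨ ⟨ x , y ⟩ , z ⟩)
      value : (x y : El a) →
              ∃! _≈_ (λ (z : El a) → ⟨ ⟨ proj₁ x , proj₁ y ⟩ , proj₁ z ⟩ ∈ g)

    apply : Op₂ (El a)
    apply x y = proj₁ (value x y)

  -- ℝ is taken to be any Dedekind-complete ordered field; ZF proves that there
  -- is one and that any two are isomorphic.
  record IsReals (ℝ : V) : Set ℓ where
    field
      add mul lt : V
      isAdd      : IsOperation add ℝ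
      isMul      : IsOperation mul ℝ
      isLt       : IsRelation lt ℝ ℝ

    infixl 7 _*_
    infixl 6 _+_
    infix  4 _<_ _≤_

    _+_ : Op₂ (El ℝ)
    _+_ = IsOperation.apply isAdd

    _*_ : Op₂ (El ℝ)
    _*_ = IsOperation.apply isMul

    _<_ : Rel (El ℝ) ℓ
    x < y = ⟨ proj₁ x , proj₁ y ⟩ ∈ lt

    _≤_ : Rel (El ℝ) ℓ
    x ≤ y = x < y ⊎ x ≈ y

    UpperBound : V → El ℝ → Set ℓ
    UpperBound S u = (x : El ℝ) → proj₁ x ∈ S → x ≤ u

    field
      -_                 : Op₁ (El ℝ)
      0# 1#              : El ℝ
      isCommutativeRing  : IsCommutativeRing _≈_ _+_ _*_ -_ 0# 1#
      0≉1                : ¬ 0# ≈ 1#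
      inverse            : ∀ x → ¬ x ≈ 0# → ∃[ y ] x * y ≈ 1#
      isStrictTotalOrder : IsStrictTotalOrder _≈_ _<_
      +-mono-<           : ∀ x y z → x < y → x + z < y + z
      *-pos              : ∀ x y → 0# < x → 0# < y → 0# < x * y
      complete           : ∀ S → S ⊆ ℝ → Nonempty S → ∃ (UpperBound S) →
                           ∃[ u ] (UpperBound S u × (∀ v → UpperBound S v → u ≤ v))

{-# OPTIONS --safe #-}
-- Write A(k) for the k-th of the given sets.  By ACω(ℝ), transported along a
-- surjection from a set of reals onto 𝒫(ω), one can choose for each n a set
-- among the { k ∣ y ∈ A(k) } with y ∈ A(n); the y giving that set form a
-- nonempty E(n) ⊆ A(n), and the E(n) are pairwise equal or disjoint.  Thus a
-- point knows the least index of its class, and DC applied to "z lies in the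
-- class that comes next after that of y" runs through all classes but finitely
-- many, for which finite choice suffices.
module Submission where

open import Level using (Level)
open import Algebra.Bundles using (CommutativeRing)
open import Algebra.Core using (Op₁; Op₂)
import Algebra.Properties.Ring as RingProperties
open import Algebra.Structures using (IsCommutativeRing)
open import Data.Bool.Base using (Bool; true; false)
open import Data.Empty using (⊥; ⊥-elim)
open import Data.Fin.Base using (Fin; zero; suc; _↑ˡ_; _↑ʳ_)
open import Data.Nat.Base using (ℕ; suc)
import Data.Nat.Base as ℕ
open import Data.Product using (∃!)
open import Data.Product.Base using (∃; ∃-syntax; _×_; _,_; proj₁; proj₂)
open import Data.Product.Function.NonDependent.Propositional using (_×-⇔_)
open import Data.Sum.Base using (_⊎_; inj₁; inj₂; [_,_]′)
open import Data.Sum.Function.Propositional using (_⊎-⇔_)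
open import Data.Vec.Base using (Vec; lookup) renaming (_∷_ to _∷ᵛ_)
import Data.Vec.Base as Vec
open import Data.Vec.Functional using (Vector; _∷_; []; _++_)
open import Data.Vec.Functional.Properties using (lookup-++ˡ; lookup-++ʳ)
open import Data.Vec.Properties using (lookup∘tabulate)
open import Function.Base using (_∘_; id)
open import Function.Bundles using (_⇔_; mk⇔; Equivalence)
open import Function.Properties.Equivalence using () renaming (trans to ⇔-trans)
open import Function.Related.TypeIsomorphisms using (→-cong-⇔; ¬-cong-⇔)
open import Relation.Binary.Core using (Rel)
import Relation.Binary.Construct.StrictToNonStrict as StrictToNonStrict
open import Relation.Binary.Definitions using (tri<; tri≈; tri>)
open import Relation.Binary.PropositionalEquality
  using (_≡_; refl; sym; trans; subst; subst₂; _≗_)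
import Relation.Binary.Reasoning.Setoid as SetoidReasoning
open import Relation.Binary.Structures using (IsStrictTotalOrder)
open import Relation.Nullary using (¬_; Dec; yes; no)
open import Relation.Nullary.Decidable using () renaming (map to map-Dec)

open import Defs

open Equivalence using (to; from)

-- The usual passage from dependent to countable choice runs `DC` on finite partial choice
-- sequences, or on pairs of an index and a point. Here `DC` is available for `X` alone, so a point
-- has to carry its index itself, which it cannot do while the given sets overlap arbitrarily. Which
-- of the sets contain a given point is recorded by a subset of ω; this is where choice from sets of
-- reals enters. `DC` leaves the first term free and asks for a relation total on `X`, although a
-- point may lie in no class and a class may be the last one. In these cases the relation admits any
-- point of any class, so the sequence may come back to a class; of several visits the earliest
-- counts. Reals are given only as a complete ordered field. Subsets of ω are coded in base 3 with
-- the digits 0 and 2, scaled to [0, 3]. Each term of a coding sequence is computed from the one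
-- after it, so the recursion starts nowhere; a greatest fixed point, obtained from suprema, takes
-- the place of a convergent series.

-- Ordered fields: the maps w/3 and w/3 + 2 on [0, 3]

module OrderedField
  {a} {A : Set a} {_≈_ _<_ : Rel A a} {_+_ _*_ : Op₂ A} { -_ : Op₁ A} {0# 1# : A}
  (isCommutativeRing : IsCommutativeRing _≈_ _+_ _*_ -_ 0# 1#)
  (0≉1 : ¬ 0# ≈ 1#)
  (inverse : ∀ x → ¬ x ≈ 0# → ∃[ y ] (x * y) ≈ 1#)
  (isStrictTotalOrder : IsStrictTotalOrder _≈_ _<_)
  (+-mono-< : ∀ x y z → x < y → (x + z) < (y + z))
  (*-pos : ∀ x y → 0# < x → 0# < y → 0# < (x * y))
  where

  commutativeRing : CommutativeRing a a
  commutativeRing = record { isCommutativeRing = isCommutativeRing }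

  open CommutativeRing commutativeRing
    using (+-cong; +-congʳ; +-comm; +-assoc; +-identityˡ; +-identityʳ; *-assoc;
           *-identityˡ; *-congʳ; distribʳ; -‿inverseʳ; -‿cong; isEquivalence; ring; setoid)
    renaming (refl to ≈-refl; sym to ≈-sym; trans to ≈-trans)
  open RingProperties ring using (+-cancelʳ; -‿distribˡ-*; -‿involutive)
  open IsStrictTotalOrder isStrictTotalOrder
    using (compare; <-resp-≈; irrefl; <-respʳ-≈; <-respˡ-≈) renaming (trans to <-trans)
  module Order = StrictToNonStrict _≈_ _<_
  open Order using (_≤_)
  open SetoidReasoning setoid

  ≤-refl : ∀ {x} → x ≤ x
  ≤-refl = inj₂ ≈-refl

  ≤-trans : ∀ {x y z} → x ≤ y → y ≤ z → x ≤ z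
  ≤-trans = Order.trans isEquivalence <-resp-≈ <-trans

  ≤-antisym : ∀ {x y} → x ≤ y → y ≤ x → x ≈ y
  ≤-antisym = Order.antisym isEquivalence <-trans irrefl

  <⇒≱ : ∀ {x y} → x < y → ¬ y ≤ x
  <⇒≱ x<y y≤x = irrefl ≈-refl (Order.<-≤-trans <-trans <-respʳ-≈ x<y y≤x)

  ≮⇒≥ : ∀ {x y} → ¬ x < y → y ≤ x
  ≮⇒≥ {x} {y} x≮y with compare x y
  ... | tri< x<y _ _ = ⊥-elim (x≮y x<y)
  ... | tri≈ _ x≈y _ = inj₂ (≈-sym x≈y)
  ... | tri> _ _ y<x = inj₁ y<x

  +-monoˡ-≤ : ∀ {x y} z → x ≤ y → (x + z) ≤ (y + z)
  +-monoˡ-≤ z (inj₁ x<y) = inj₁ (+-mono-< _ _ z x<y)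
  +-monoˡ-≤ z (inj₂ x≈y) = inj₂ (+-congʳ x≈y)

  +-mono-≤ : ∀ {x y z w} → x ≤ y → z ≤ w → (x + z) ≤ (y + w)
  +-mono-≤ {x} {y} {z} {w} x≤y z≤w = ≤-trans (+-monoˡ-≤ z x≤y)
    (≤-trans (inj₂ (+-comm y z)) (≤-trans (+-monoˡ-≤ y z≤w) (inj₂ (+-comm w y))))

  +-mono-<-≤ : ∀ {x y z w} → x < y → z ≤ w → (x + z) < (y + w)
  +-mono-<-≤ {z = z} x<y z≤w =
    Order.<-≤-trans <-trans <-respʳ-≈ (+-mono-< _ _ z x<y) (+-mono-≤ ≤-refl z≤w)

  0<1 : 0# < 1#
  0<1 with compare 0# 1#
  ... | tri< 0<1 _ _ = 0<1
  ... | tri≈ _ 0≈1 _ = ⊥-elim (0≉1 0≈1)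
  -- This case is not refuted: it yields the claim itself, as 1 is the square of the positive
  -- element -1.
  ... | tri> _ _ 1<0 = <-respʳ-≈ [-1]²≈1 (*-pos _ _ 0<-1 0<-1)
    where
    0<-1 : 0# < (- 1#)
    0<-1 = <-respˡ-≈ (-‿inverseʳ 1#) (<-respʳ-≈ (+-identityˡ (- 1#)) (+-mono-< _ _ (- 1#) 1<0))
    [-1]²≈1 : ((- 1#) * (- 1#)) ≈ 1#
    [-1]²≈1 = begin
      (- 1#) * (- 1#)  ≈⟨ -‿distribˡ-* 1# (- 1#) ⟨
      - (1# * (- 1#))  ≈⟨ -‿cong (*-identityˡ (- 1#)) ⟩
      - (- 1#)         ≈⟨ -‿involutive 1# ⟩
      1#               ∎

  triple : Op₁ A
  triple x = (x + x) + x

  2# 3# : A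
  2# = 1# + 1#
  3# = triple 1#

  triple-0 : triple 0# ≈ 0#
  triple-0 = ≈-trans (+-identityʳ (0# + 0#)) (+-identityʳ 0#)

  triple-< : ∀ {x y} → x < y → triple x < triple y
  triple-< x<y = +-mono-<-≤ (+-mono-<-≤ x<y (inj₁ x<y)) (inj₁ x<y)

  triple-reflects-≤ : ∀ {x y} → triple x ≤ triple y → x ≤ y
  triple-reflects-≤ 3x≤3y = ≮⇒≥ λ y<x → <⇒≱ (triple-< y<x) 3x≤3y

  3≉0 : ¬ 3# ≈ 0#
  3≉0 3≈0 = irrefl (≈-trans triple-0 (≈-sym 3≈0)) (triple-< 0<1)

  third : ∀ w → ∃[ y ] triple y ≈ w
  third w = let a , 3a≈1 = inverse 3# 3≉0 in a * w , (begin
    triple (a * w)                               ≈⟨ +-cong (+-cong one one) one ⟨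
    ((1# * (a * w)) + (1# * (a * w))) + (1# * (a * w)) ≈⟨ +-congʳ (distribʳ (a * w) 1# 1#) ⟨
    (2# * (a * w)) + (1# * (a * w))              ≈⟨ distribʳ (a * w) 2# 1# ⟨
    3# * (a * w)                                 ≈⟨ *-assoc 3# a w ⟨
    (3# * a) * w                                 ≈⟨ *-congʳ 3a≈1 ⟩
    1# * w                                       ≈⟨ *-identityˡ w ⟩
    w                                            ∎)
    where
    one : ∀ {x} → (1# * x) ≈ x
    one = *-identityˡ _

  InInterval : A → Set a
  InInterval x = 0# ≤ x × x ≤ 3#

  -- The third of `w` is described by `triple y ≈ w` instead of a product, so that the relation can
  -- be written as a set-theoretic formula that mentions only the graph of addition and `d`.
  Contraction : A → A → A → Set a
  Contraction d w v = ∃[ y ] (triple y ≈ w × (y + d) ≈ v)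

  0≤1 : 0# ≤ 1#
  0≤1 = inj₁ 0<1

  0≤2 : 0# ≤ 2#
  0≤2 = ≤-trans (inj₂ (≈-sym (+-identityʳ 0#))) (+-mono-≤ 0≤1 0≤1)

  0≤3 : 0# ≤ 3#
  0≤3 = ≤-trans (inj₂ (≈-sym (+-identityʳ 0#))) (+-mono-≤ 0≤2 0≤1)

  third-bounds : ∀ {w y} → InInterval w → triple y ≈ w → 0# ≤ y × y ≤ 1#
  third-bounds (0≤w , w≤3) 3y≈w =
    triple-reflects-≤ (≤-trans (inj₂ triple-0) (≤-trans 0≤w (inj₂ (≈-sym 3y≈w)))) ,
    triple-reflects-≤ (≤-trans (inj₂ 3y≈w) w≤3)

  contraction-total : ∀ d w → 0# ≤ d → d ≤ 2# → InInterval w →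
                      ∃[ v ] (InInterval v × Contraction d w v)
  contraction-total d w 0≤d d≤2 w∈ =
    let y , 3y≈w  = third w
        0≤y , y≤1 = third-bounds w∈ 3y≈w
    in y + d
     , ( ≤-trans (inj₂ (≈-sym (+-identityʳ 0#))) (+-mono-≤ 0≤y 0≤d)
       , ≤-trans (+-mono-≤ y≤1 d≤2) (inj₂ (≈-sym (+-assoc 1# 1# 1#))))
     , y , 3y≈w , ≈-refl

  contraction-monotone : ∀ d w w′ v v′ → Contraction d w v → Contraction d w′ v′ →
                         w ≤ w′ → v ≤ v′
  contraction-monotone d _ _ _ _ (y , 3y≈w , y+d≈v) (y′ , 3y′≈w′ , y′+d≈v′) w≤w′ =
    ≤-trans (inj₂ (≈-sym y+d≈v))
      (≤-trans (+-monoˡ-≤ d (triple-reflects-≤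
                  (≤-trans (inj₂ 3y≈w) (≤-trans w≤w′ (inj₂ (≈-sym 3y′≈w′))))))
        (inj₂ y′+d≈v′))

  contraction-injective : ∀ d w w′ v → Contraction d w v → Contraction d w′ v → w ≈ w′
  contraction-injective d w w′ v (y , 3y≈w , y+d≈v) (y′ , 3y′≈w′ , y′+d≈v) = begin
    w         ≈⟨ 3y≈w ⟨
    triple y  ≈⟨ +-cong (+-cong y≈y′ y≈y′) y≈y′ ⟩
    triple y′ ≈⟨ 3y′≈w′ ⟩
    w′        ∎
    where y≈y′ = +-cancelʳ d y y′ (≈-trans y+d≈v (≈-sym y′+d≈v))

  -- The images of [0, 3] under w/3 + 2 and w/3 lie in [2, 3] and [0, 1], and 1 < 2.
  contraction-disjoint : ∀ w w′ v → InInterval w → InInterval w′ →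
                         Contraction 2# w v → ¬ Contraction 0# w′ v
  contraction-disjoint w w′ v w∈ w′∈ (y , 3y≈w , y+2≈v) (y′ , 3y′≈w′ , y′+0≈v) =
    <⇒≱ (<-respˡ-≈ (+-identityˡ 1#) (+-mono-< 0# 1# 1# 0<1))
      (≤-trans (inj₂ (≈-sym (+-identityˡ 2#)))
        (≤-trans (+-monoˡ-≤ 2# (proj₁ (third-bounds w∈ 3y≈w)))
          (≤-trans (inj₂ (≈-trans y+2≈v (≈-trans (≈-sym y′+0≈v) (+-identityʳ y′))))
            (proj₂ (third-bounds w′∈ 3y′≈w′)))))

-- First-order definability in a model of ZF

module _ {ℓ : Level} {V : Set ℓ} {_∈_ : Rel V ℓ} (zf : ZF V _∈_) where

  open ZF zf
  open Notions zf

  private variable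
    n m : ℕ
    P Q : Vector V n → Set ℓ

  -- Definability with parameters.  The formula may be placed in any larger
  -- context: σ and τ say where its free variables and its parameters sit, so
  -- that conjoining formulas with different parameters needs no renaming of
  -- formulas.
  record Definable {n : ℕ} (P : Vector V n → Set ℓ) : Set ℓ where
    field
      {arity}    : ℕ
      parameters : Vector V arity
      formula    : ∀ {k} → (Fin n → Fin k) → (Fin arity → Fin k) → Formula k
      correct    : ∀ {k} {σ : Fin n → Fin k} {τ : Fin arity → Fin k}
                   (ρ : Vector V n) (ρ′ : Vec V k) →
                   lookup ρ′ ∘ σ ≗ ρ → lookup ρ′ ∘ τ ≗ parameters →
                   (ρ′ ⊨ formula σ τ) ⇔ P ρ

  open Definable

  definable-resp : (∀ ρ → P ρ ⇔ Q ρ) → Definable P → Definable Q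
  definable-resp P⇔Q d = record
    { parameters = parameters d
    ; formula    = formula d
    ; correct    = λ ρ ρ′ p q → ⇔-trans (correct d ρ ρ′ p q) (P⇔Q ρ) }

  -- Valuations are functions, and pointwise equal functions need not be provably equal. A definable
  -- `P` respects pointwise equality all the same, being equivalent to a formula that looks up
  -- values only.
  definable-cong : Definable P → ∀ {ρ ρ′} → ρ ≗ ρ′ → P ρ → P ρ′
  definable-cong d {ρ} {ρ′} e = to (correct d ρ′ v (λ i → trans (free i) (e i)) bound)
                              ∘ from (correct d ρ v free bound)
    where
    v = Vec.tabulate (ρ ++ parameters d)
    free : lookup v ∘ (_↑ˡ arity d) ≗ ρ
    free i = trans (lookup∘tabulate (ρ ++ parameters d) (i ↑ˡ arity d)) (lookup-++ˡ ρ (parameters d) i)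
    bound : lookup v ∘ (_ ↑ʳ_) ≗ parameters d
    bound i = trans (lookup∘tabulate (ρ ++ parameters d) (_ ↑ʳ i)) (lookup-++ʳ ρ (parameters d) i)

  definable-rename : (θ : Fin n → Fin m) → Definable P → Definable (λ ρ → P (ρ ∘ θ))
  definable-rename θ d = record
    { parameters = parameters d
    ; formula    = λ σ τ → formula d (σ ∘ θ) τ
    ; correct    = λ ρ ρ′ p q → correct d (ρ ∘ θ) ρ′ (p ∘ θ) q }

  definable-∈ : (i j : Fin n) → Definable (λ ρ → ρ i ∈ ρ j)
  definable-∈ i j = record
    { parameters = []
    ; formula    = λ σ τ → σ i ∈′ σ j
    ; correct    = λ ρ ρ′ p q → mk⇔ (subst₂ _∈_ (p i) (p j))
                                    (subst₂ _∈_ (sym (p i)) (sym (p j))) }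

  definable-≡ : (i j : Fin n) → Definable (λ ρ → ρ i ≡ ρ j)
  definable-≡ i j = record
    { parameters = []
    ; formula    = λ σ τ → σ i ≡′ σ j
    ; correct    = λ ρ ρ′ p q → mk⇔ (subst₂ _≡_ (p i) (p j))
                                    (subst₂ _≡_ (sym (p i)) (sym (p j))) }

  definable-≡const : (i : Fin n) (c : V) → Definable (λ ρ → ρ i ≡ c)
  definable-≡const i c = record
    { parameters = c ∷ []
    ; formula    = λ σ τ → σ i ≡′ τ zero
    ; correct    = λ ρ ρ′ p q → mk⇔ (subst₂ _≡_ (p i) (q zero))
                                    (subst₂ _≡_ (sym (p i)) (sym (q zero))) }

  definable-¬ : Definable P → Definable (λ ρ → ¬ P ρ)
  definable-¬ d = record
    { parameters = parameters d
    ; formula    = λ σ τ → ¬′ formula d σ τ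
    ; correct    = λ ρ ρ′ p q → ¬-cong-⇔ (correct d ρ ρ′ p q) }

  definable-binary :
    {_⊙_ : Set ℓ → Set ℓ → Set ℓ} (_⊙′_ : ∀ {k} → Formula k → Formula k → Formula k) →
    (∀ {k} (φ ψ : Formula k) (ρ : Vec V k) {A B : Set ℓ} →
      (ρ ⊨ φ) ⇔ A → (ρ ⊨ ψ) ⇔ B → (ρ ⊨ (φ ⊙′ ψ)) ⇔ (A ⊙ B)) →
    Definable P → Definable Q → Definable (λ ρ → P ρ ⊙ Q ρ)
  definable-binary _⊙′_ ⊙-correct d e = record
    { parameters = parameters d ++ parameters e
    ; formula    = λ σ τ → formula d σ (τ ∘ (_↑ˡ arity e)) ⊙′ formula e σ (τ ∘ (arity d ↑ʳ_))
    ; correct    = λ ρ ρ′ p q → ⊙-correct _ _ ρ′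
        (correct d ρ ρ′ p (λ i → trans (q (i ↑ˡ arity e)) (lookup-++ˡ (parameters d) (parameters e) i)))
        (correct e ρ ρ′ p (λ i → trans (q (arity d ↑ʳ i)) (lookup-++ʳ (parameters d) (parameters e) i))) }

  definable-× : Definable P → Definable Q → Definable (λ ρ → P ρ × Q ρ)
  definable-× = definable-binary _∧′_ (λ _ _ _ → _×-⇔_)

  definable-⊎ : Definable P → Definable Q → Definable (λ ρ → P ρ ⊎ Q ρ)
  definable-⊎ = definable-binary _∨′_ (λ _ _ _ → _⊎-⇔_)

  definable-→ : Definable P → Definable Q → Definable (λ ρ → P ρ → Q ρ)
  definable-→ = definable-binary _⇒′_ (λ _ _ _ → →-cong-⇔)

  private
    lift : ∀ {k} → (Fin n → Fin k) → Fin (suc n) → Fin (suc k)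
    lift σ zero    = zero
    lift σ (suc i) = suc (σ i)

    lookup-lift : ∀ {k} {σ : Fin n → Fin k} {ρ : Vector V n} {ρ′ : Vec V k} x →
                  lookup ρ′ ∘ σ ≗ ρ → lookup (x ∷ᵛ ρ′) ∘ lift σ ≗ (x ∷ ρ)
    lookup-lift x p zero    = refl
    lookup-lift x p (suc i) = p i

  definable-∀ : Definable P → Definable (λ ρ → ∀ x → P (x ∷ ρ))
  definable-∀ d = record
    { parameters = parameters d
    ; formula    = λ σ τ → ∀′ formula d (lift σ) (suc ∘ τ)
    ; correct    = λ ρ ρ′ p q →
        let c = λ x → correct d (x ∷ ρ) (x ∷ᵛ ρ′) (lookup-lift x p) q in
        mk⇔ (λ f x → to (c x) (f x)) (λ f x → from (c x) (f x)) }

  definable-∃ : Definable P → Definable (λ ρ → ∃[ x ] P (x ∷ ρ))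
  definable-∃ d = record
    { parameters = parameters d
    ; formula    = λ σ τ → ∃′ formula d (lift σ) (suc ∘ τ)
    ; correct    = λ ρ ρ′ p q →
        let c = λ x → correct d (x ∷ ρ) (x ∷ᵛ ρ′) (lookup-lift x p) q in
        mk⇔ (λ (x , f) → x , to (c x) f) (λ (x , f) → x , from (c x) f) }

  separate : {P : Vector V 1 → Set ℓ} → Definable P → ∀ a →
             ∃[ s ] (∀ z → z ∈ s ⇔ (z ∈ a × P (z ∷ [])))
  separate {P} d a =
    let s , s-spec = separation (formula d (λ _ → zero) suc) (Vec.tabulate (parameters d)) a in
    s , λ z → ⇔-trans (s-spec z)
      (mk⇔ id id ×-⇔ correct d (z ∷ []) (z ∷ᵛ _) (λ { zero → refl })
                      (lookup∘tabulate (parameters d)))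

  decide : {P : Vector V 0 → Set ℓ} → Definable P → Dec (P [])
  decide d = map-Dec (correct d [] _ (λ ()) (lookup∘tabulate (parameters d)))
                     (excludedMiddle (formula d (λ ()) id) (Vec.tabulate (parameters d)))

  -- Formulas with set terms, and their elimination

  infix  9 ⋃ₜ_
  infix  6 _∈ₜ_ _≡ₜ_
  infix  5 ¬ₜ_
  infixr 4 _∧ₜ_
  infixr 3 _∨ₜ_
  infixr 2 _⇒ₜ_ _⇔ₜ_
  infix  1 ∀ₜ_ ∃ₜ_

  -- The language of Defs extended by constants for the elements of V and by terms for
  -- unordered pairs and unions.
  data Term (n : ℕ) : Set ℓ where
    var     : Fin n → Term n
    `_      : V → Term n
    ⟅_,_⟆ₜ  : Term n → Term n → Term n
    ⋃ₜ_     : Term n → Term n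

  data Formulaₜ (n : ℕ) : Set ℓ where
    _∈ₜ_ _≡ₜ_      : Term n → Term n → Formulaₜ n
    ¬ₜ_            : Formulaₜ n → Formulaₜ n
    _∧ₜ_ _∨ₜ_ _⇒ₜ_ : Formulaₜ n → Formulaₜ n → Formulaₜ n
    ∀ₜ_ ∃ₜ_        : Formulaₜ (suc n) → Formulaₜ n

  ⟨_,_⟩ₜ : Term n → Term n → Term n
  ⟨ t , u ⟩ₜ = ⟅ ⟅ t , t ⟆ₜ , ⟅ t , u ⟆ₜ ⟆ₜ

  succₜ : Term n → Term n
  succₜ t = ⋃ₜ ⟅ t , ⟅ t , t ⟆ₜ ⟆ₜ

  _⇔ₜ_ : Formulaₜ n → Formulaₜ n → Formulaₜ n
  φ ⇔ₜ ψ = (φ ⇒ₜ ψ) ∧ₜ (ψ ⇒ₜ φ)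

  x₀ : Term (1 ℕ.+ n)
  x₀ = var zero
  x₁ : Term (2 ℕ.+ n)
  x₁ = var (suc zero)
  x₂ : Term (3 ℕ.+ n)
  x₂ = var (suc (suc zero))
  x₃ : Term (4 ℕ.+ n)
  x₃ = var (suc (suc (suc zero)))
  x₄ : Term (5 ℕ.+ n)
  x₄ = var (suc (suc (suc (suc zero))))
  x₅ : Term (6 ℕ.+ n)
  x₅ = var (suc (suc (suc (suc (suc zero)))))

  ⟦_⟧ₜ : Term n → Vector V n → V
  ⟦ var i ⟧ₜ ρ      = ρ i
  ⟦ ` c ⟧ₜ ρ        = c
  ⟦ ⟅ t , u ⟆ₜ ⟧ₜ ρ = ⟅ ⟦ t ⟧ₜ ρ , ⟦ u ⟧ₜ ρ ⟆
  ⟦ ⋃ₜ t ⟧ₜ ρ       = ⋃ (⟦ t ⟧ₜ ρ)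

  -- Evaluation computes to the statement written with the operations of `V`. Formulas handed to
  -- `induction`, `em` or a comprehension thus match the Agda statements about them definitionally.
  ⟦_⟧ : Formulaₜ n → Vector V n → Set ℓ
  ⟦ t ∈ₜ u ⟧ ρ = ⟦ t ⟧ₜ ρ ∈ ⟦ u ⟧ₜ ρ
  ⟦ t ≡ₜ u ⟧ ρ = ⟦ t ⟧ₜ ρ ≡ ⟦ u ⟧ₜ ρ
  ⟦ ¬ₜ φ ⟧   ρ = ¬ ⟦ φ ⟧ ρ
  ⟦ φ ∧ₜ ψ ⟧ ρ = ⟦ φ ⟧ ρ × ⟦ ψ ⟧ ρ
  ⟦ φ ∨ₜ ψ ⟧ ρ = ⟦ φ ⟧ ρ ⊎ ⟦ ψ ⟧ ρ
  ⟦ φ ⇒ₜ ψ ⟧ ρ = ⟦ φ ⟧ ρ → ⟦ ψ ⟧ ρ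
  ⟦ ∀ₜ φ ⟧   ρ = ∀ x → ⟦ φ ⟧ (x ∷ ρ)
  ⟦ ∃ₜ φ ⟧   ρ = ∃[ x ] ⟦ φ ⟧ (x ∷ ρ)

  ≡-spec : {B : V → Set ℓ} {x y : V} → (∀ z → z ∈ y ⇔ B z) →
           (x ≡ y) ⇔ (∀ z → (z ∈ x → B z) × (B z → z ∈ x))
  ≡-spec y-spec = mk⇔
    (λ { refl z → to (y-spec z) , from (y-spec z) })
    (λ s → extensionality _ _ λ z →
      mk⇔ (from (y-spec z) ∘ proj₁ (s z)) (proj₂ (s z) ∘ to (y-spec z)))

  -- The basic language has no function symbols. A compound term is unwound by quantifying over the
  -- values of its subterms and describing the pair or union through its elements.
  definable-graph : (t : Term n) → Definable (λ (ρ : Vector V (suc n)) → ρ zero ≡ ⟦ t ⟧ₜ (ρ ∘ suc))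
  definable-graph (var i) = definable-≡ zero (suc i)
  definable-graph (` c)   = definable-≡const zero c
  definable-graph {n} ⟅ t , u ⟆ₜ = definable-resp
    (λ ρ → mk⇔
      (λ { (_ , _ , refl , refl , s) → from (≡-spec (proj₂ (pairing _ _))) s })
      (λ e → _ , _ , refl , refl , to (≡-spec (proj₂ (pairing _ _))) e))
    (definable-∃ (definable-∃ (definable-×
      (definable-rename (λ { zero → suc zero ; (suc i) → suc (suc (suc i)) }) (definable-graph t))
      (definable-× (definable-rename (λ { zero → zero ; (suc i) → suc (suc (suc i)) }) (definable-graph u))
        (definable-∀ (definable-×
          (definable-→ z∈x (definable-⊎ z≡a z≡b)) (definable-→ (definable-⊎ z≡a z≡b) z∈x)))))))
    where
    z∈x : Definable (λ (ρ : Vector V (4 ℕ.+ n)) → ρ zero ∈ ρ (suc (suc (suc zero))))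
    z∈x = definable-∈ _ _
    z≡a : Definable (λ (ρ : Vector V (4 ℕ.+ n)) → ρ zero ≡ ρ (suc (suc zero)))
    z≡a = definable-≡ _ _
    z≡b : Definable (λ (ρ : Vector V (4 ℕ.+ n)) → ρ zero ≡ ρ (suc zero))
    z≡b = definable-≡ _ _
  definable-graph {n} (⋃ₜ t) = definable-resp
    (λ ρ → mk⇔
      (λ { (_ , refl , s) → from (≡-spec (proj₂ (union _))) s })
      (λ e → _ , refl , to (≡-spec (proj₂ (union _))) e))
    (definable-∃ (definable-×
      (definable-rename (λ { zero → zero ; (suc i) → suc (suc i) }) (definable-graph t))
      (definable-∀ (definable-× (definable-→ z∈x z∈⋃a) (definable-→ z∈⋃a z∈x)))))
    where
    z∈x : Definable (λ (ρ : Vector V (3 ℕ.+ n)) → ρ zero ∈ ρ (suc (suc zero)))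
    z∈x = definable-∈ _ _
    z∈⋃a : Definable (λ (ρ : Vector V (3 ℕ.+ n)) → ∃[ y ] (y ∈ ρ (suc zero) × ρ zero ∈ y))
    z∈⋃a = definable-∃ (definable-× (definable-∈ zero (suc (suc zero))) (definable-∈ (suc zero) zero))

  definable-atom : (_∼_ : V → V → Set ℓ) (t u : Term n) →
                   Definable {2 ℕ.+ n} (λ ρ → ρ (suc zero) ∼ ρ zero) →
                   Definable (λ ρ → ⟦ t ⟧ₜ ρ ∼ ⟦ u ⟧ₜ ρ)
  definable-atom _∼_ t u d = definable-resp
    (λ ρ → mk⇔ (λ (a , b , p , q , s) → subst₂ _∼_ p q s) (λ s → _ , _ , refl , refl , s))
    (definable-∃ (definable-∃ (definable-×
      (definable-rename (λ { zero → suc zero ; (suc i) → suc (suc i) }) (definable-graph t))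
      (definable-× (definable-rename (λ { zero → zero ; (suc i) → suc (suc i) }) (definable-graph u)) d))))

  abstract
    definable : (φ : Formulaₜ n) → Definable ⟦ φ ⟧
    definable (t ∈ₜ u) = definable-atom _∈_ t u (definable-∈ (suc zero) zero)
    definable (t ≡ₜ u) = definable-atom _≡_ t u (definable-≡ (suc zero) zero)
    definable (¬ₜ φ)   = definable-¬ (definable φ)
    definable (φ ∧ₜ ψ) = definable-× (definable φ) (definable ψ)
    definable (φ ∨ₜ ψ) = definable-⊎ (definable φ) (definable ψ)
    definable (φ ⇒ₜ ψ) = definable-→ (definable φ) (definable ψ)
    definable (∀ₜ φ)   = definable-∀ (definable φ)
    definable (∃ₜ φ)   = definable-∃ (definable φ)

  abstract
    ｛_∣_｝ : V → Formulaₜ 1 → V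
    ｛ a ∣ φ ｝ = proj₁ (separate (definable φ) a)

    ∈-｛∣｝ : ∀ a (φ : Formulaₜ 1) {z} → z ∈ ｛ a ∣ φ ｝ ⇔ (z ∈ a × ⟦ φ ⟧ (z ∷ []))
    ∈-｛∣｝ a φ = proj₂ (separate (definable φ) a) _

    em : (φ : Formulaₜ 0) → Dec (⟦ φ ⟧ [])
    em φ = decide (definable φ)

  -- Pairs, products, relations and functions

  ∈-≡ : ∀ {x y z} → x ∈ y → y ≡ z → x ∈ z
  ∈-≡ x∈y refl = x∈y

  ∈-pair⁻ : ∀ {x y z} → z ∈ ⟅ x , y ⟆ → z ≡ x ⊎ z ≡ y
  ∈-pair⁻ = to (proj₂ (pairing _ _) _)

  ∈-pairˡ : ∀ {x y} → x ∈ ⟅ x , y ⟆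
  ∈-pairˡ = from (proj₂ (pairing _ _) _) (inj₁ refl)

  ∈-pairʳ : ∀ {x y} → y ∈ ⟅ x , y ⟆
  ∈-pairʳ = from (proj₂ (pairing _ _) _) (inj₂ refl)

  ∈-𝒫 : ∀ {x y} → y ∈ 𝒫 x ⇔ y ⊆ x
  ∈-𝒫 = proj₂ (powerSet _) _

  private
    singleton-pair : ∀ {x y z} → ⟅ y , z ⟆ ≡ ⟅ x , x ⟆ → y ≡ x × z ≡ x
    singleton-pair e =
      [ id , id ]′ (∈-pair⁻ (∈-≡ ∈-pairˡ e)) , [ id , id ]′ (∈-pair⁻ (∈-≡ ∈-pairʳ e))

  ⟨⟩-injectiveˡ : ∀ {x y x′ y′} → ⟨ x , y ⟩ ≡ ⟨ x′ , y′ ⟩ → x ≡ x′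
  ⟨⟩-injectiveˡ e with ∈-pair⁻ (∈-≡ ∈-pairˡ e)
  ... | inj₁ p = proj₁ (singleton-pair p)
  ... | inj₂ p = sym (proj₁ (singleton-pair (sym p)))

  private
    ⟨⟩-injectiveʳ′ : ∀ {x y y′} → ⟨ x , y ⟩ ≡ ⟨ x , y′ ⟩ → y ≡ x ⊎ y ≡ y′
    ⟨⟩-injectiveʳ′ e with ∈-pair⁻ (∈-≡ ∈-pairʳ e)
    ... | inj₁ p = inj₁ (proj₂ (singleton-pair p))
    ... | inj₂ p = ∈-pair⁻ (∈-≡ ∈-pairʳ p)

  ⟨⟩-injectiveʳ : ∀ {x y x′ y′} → ⟨ x , y ⟩ ≡ ⟨ x′ , y′ ⟩ → y ≡ y′
  ⟨⟩-injectiveʳ e with ⟨⟩-injectiveˡ e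
  ... | refl with ⟨⟩-injectiveʳ′ e | ⟨⟩-injectiveʳ′ (sym e)
  ... | inj₂ p | _      = p
  ... | inj₁ _ | inj₂ q = sym q
  ... | inj₁ p | inj₁ q = trans p (sym q)

  private
    isPairₜ : V → V → Formulaₜ 1
    isPairₜ a b = ∃ₜ ∃ₜ (x₁ ∈ₜ ` a ∧ₜ x₀ ∈ₜ ` b ∧ₜ x₂ ≡ₜ ⟨ x₁ , x₀ ⟩ₜ)

  _⊗_ : V → V → V
  a ⊗ b = ｛ 𝒫 (𝒫 (⋃ ⟅ a , b ⟆)) ∣ isPairₜ a b ｝

  ⟨⟩∈⊗ : ∀ {a b x y} → x ∈ a → y ∈ b → ⟨ x , y ⟩ ∈ (a ⊗ b)
  ⟨⟩∈⊗ {a} {b} {x} {y} x∈a y∈b = from (∈-｛∣｝ _ (isPairₜ a b))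
    (from ∈-𝒫 (λ p p∈ → from ∈-𝒫 (λ z z∈p → inUnion p∈ z∈p)) , x , y , x∈a , y∈b , refl)
    where
    inA : ∀ {z} → z ≡ x → z ∈ ⋃ ⟅ a , b ⟆
    inA refl = from (proj₂ (union _) _) (a , ∈-pairˡ , x∈a)
    inB : ∀ {z} → z ≡ y → z ∈ ⋃ ⟅ a , b ⟆
    inB refl = from (proj₂ (union _) _) (b , ∈-pairʳ , y∈b)
    inUnion : ∀ {p z} → p ∈ ⟨ x , y ⟩ → z ∈ p → z ∈ ⋃ ⟅ a , b ⟆
    inUnion p∈ z∈p with ∈-pair⁻ p∈
    ... | inj₁ refl = [ inA , inA ]′ (∈-pair⁻ z∈p)
    ... | inj₂ refl = [ inA , inB ]′ (∈-pair⁻ z∈p)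

  private
    -- Under the two quantifiers the context is second component, first component, pair. The
    -- renaming restores the order of the components and hides the pair from the formula.
    swap₃ : Fin 2 → Fin 3
    swap₃ zero    = suc zero
    swap₃ (suc _) = zero

    swap₃-∷ : {x y z : V} → (y ∷ x ∷ z ∷ []) ∘ swap₃ ≗ (x ∷ y ∷ [])
    swap₃-∷ zero       = refl
    swap₃-∷ (suc zero) = refl

    separateRelation : (a b : V) (φ : Formulaₜ 2) →
      ∃[ s ] (∀ z → z ∈ s ⇔ (z ∈ (a ⊗ b) ×
        (∃[ x ] ∃[ y ] (z ≡ ⟨ x , y ⟩ × ⟦ φ ⟧ ((y ∷ x ∷ z ∷ []) ∘ swap₃)))))
    separateRelation a b φ = separate (definable-∃ (definable-∃ (definable-×
      (definable (x₂ ≡ₜ ⟨ x₁ , x₀ ⟩ₜ)) (definable-rename swap₃ (definable φ))))) (a ⊗ b)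

  abstract
    -- The variables x₀ and x₁ of φ stand for the first and second component.
    ｛_⨾_∣_｝ : V → V → Formulaₜ 2 → V
    ｛ a ⨾ b ∣ φ ｝ = proj₁ (separateRelation a b φ)

  module _ (a b : V) (φ : Formulaₜ 2) where

    abstract
      relation-isRelation : IsRelation ｛ a ⨾ b ∣ φ ｝ a b
      relation-isRelation p p∈r =
        proj₂ (to (∈-｛∣｝ _ (isPairₜ a b)) (proj₁ (to (proj₂ (separateRelation a b φ) p) p∈r)))

      ∈-relation⁺ : ∀ {x y} → x ∈ a → y ∈ b → ⟦ φ ⟧ (x ∷ y ∷ []) → ⟨ x , y ⟩ ∈ ｛ a ⨾ b ∣ φ ｝
      ∈-relation⁺ {x} {y} x∈a y∈b p = from (proj₂ (separateRelation a b φ) _)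
        (⟨⟩∈⊗ x∈a y∈b , x , y , refl , definable-cong (definable φ) (sym ∘ swap₃-∷) p)

      ∈-relation⁻ : ∀ {x y} → ⟨ x , y ⟩ ∈ ｛ a ⨾ b ∣ φ ｝ → x ∈ a × y ∈ b × ⟦ φ ⟧ (x ∷ y ∷ [])
      ∈-relation⁻ q with to (proj₂ (separateRelation a b φ) _) q
      ... | q∈⊗ , x , y , e , p with to (∈-｛∣｝ _ (isPairₜ a b)) q∈⊗
      ... | _ , _ , _ , x∈a , y∈b , e′
        with ⟨⟩-injectiveˡ e | ⟨⟩-injectiveʳ e | ⟨⟩-injectiveˡ e′ | ⟨⟩-injectiveʳ e′
      ... | refl | refl | refl | refl = x∈a , y∈b , definable-cong (definable φ) swap₃-∷ p

  relation-∈ : ∀ {r a b x y} → IsRelation r a b → ⟨ x , y ⟩ ∈ r → x ∈ a × y ∈ b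
  relation-∈ r-rel p with r-rel _ p
  ... | _ , _ , x∈a , y∈b , e with ⟨⟩-injectiveˡ e | ⟨⟩-injectiveʳ e
  ... | refl | refl = x∈a , y∈b

  function-total : ∀ {f a b x} → IsFunction f a b → x ∈ a → ∃[ y ] ⟨ x , y ⟩ ∈ f
  function-total (_ , f-fun) x∈a = let y , p , _ = f-fun _ x∈a in y , p

  function-unique : ∀ {f a b x y z} → IsFunction f a b →
                    ⟨ x , y ⟩ ∈ f → ⟨ x , z ⟩ ∈ f → y ≡ z
  function-unique (f-rel , f-fun) p q =
    let _ , _ , unique = f-fun _ (proj₁ (relation-∈ f-rel p)) in
    trans (sym (unique p)) (unique q)

  isFunction : ∀ {f a b} → IsRelation f a b → (∀ x → x ∈ a → ∃[ y ] ⟨ x , y ⟩ ∈ f) →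
               (∀ {x y z} → ⟨ x , y ⟩ ∈ f → ⟨ x , z ⟩ ∈ f → y ≡ z) → IsFunction f a b
  isFunction f-rel total unique =
    f-rel , λ x x∈a → let y , p = total x x∈a in y , p , unique p

  ⊆-antisym : ∀ {x y} → x ⊆ y → y ⊆ x → x ≡ y
  ⊆-antisym x⊆y y⊆x = extensionality _ _ λ z → mk⇔ (x⊆y z) (y⊆x z)

  -- Countable choice as uniformisation

  -- Countable choice with the sequence of sets given by the sections of `B`, which spares
  -- collecting them into a function from ω to a power set at each use.
  UniformisationOn : V → V → Set ℓ
  UniformisationOn ω Y =
    ∀ B → (∀ n → n ∈ ω → ∃[ y ] (y ∈ Y × ⟨ n , y ⟩ ∈ B)) →
    ∃[ f ] (IsFunction f ω Y × (∀ {n y} → ⟨ n , y ⟩ ∈ f → ⟨ n , y ⟩ ∈ B))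

  ACω⇒uniformisation : ∀ {ω Y} → ACω ω Y → UniformisationOn ω Y
  ACω⇒uniformisation {ω} {Y} ac B B-total =
    let f , f-fun , f-choice = ac A (relation-isRelation ω (𝒫 Y) φ , A-fun) A-nonempty in
    f , f-fun , λ p → proj₂ (to ∈-fibre (f-choice _ _ _ (⟨⟩∈A (proj₁ (relation-∈ (proj₁ f-fun) p))) p))
    where
    fibreₜ : V → Formulaₜ 1
    fibreₜ n = ⟨ ` n , x₀ ⟩ₜ ∈ₜ ` B

    ∈-fibre : ∀ {n y} → y ∈ ｛ Y ∣ fibreₜ n ｝ ⇔ (y ∈ Y × ⟨ n , y ⟩ ∈ B)
    ∈-fibre = ∈-｛∣｝ Y (fibreₜ _)

    φ : Formulaₜ 2
    φ = ∀ₜ x₀ ∈ₜ x₂ ⇔ₜ x₀ ∈ₜ ` Y ∧ₜ ⟨ x₁ , x₀ ⟩ₜ ∈ₜ ` B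

    A = ｛ ω ⨾ 𝒫 Y ∣ φ ｝

    ⟨⟩∈A : ∀ {n} → n ∈ ω → ⟨ n , ｛ Y ∣ fibreₜ n ｝ ⟩ ∈ A
    ⟨⟩∈A n∈ω = ∈-relation⁺ ω (𝒫 Y) φ n∈ω (from ∈-𝒫 λ y → proj₁ ∘ to ∈-fibre)
                           (λ y → to ∈-fibre , from ∈-fibre)

    A-unique : ∀ {n b} → ⟨ n , b ⟩ ∈ A → ｛ Y ∣ fibreₜ n ｝ ≡ b
    A-unique p = let _ , _ , spec = ∈-relation⁻ ω (𝒫 Y) φ p in
      ⊆-antisym (λ y → proj₂ (spec y) ∘ to ∈-fibre) (λ y → from ∈-fibre ∘ proj₁ (spec y))

    A-fun : ∀ n → n ∈ ω → ∃! _≡_ (λ b → ⟨ n , b ⟩ ∈ A)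
    A-fun n n∈ω = _ , ⟨⟩∈A n∈ω , A-unique

    A-nonempty : ∀ n b → ⟨ n , b ⟩ ∈ A → Nonempty b
    A-nonempty n b p = let n∈ω , _ , spec = ∈-relation⁻ ω (𝒫 Y) φ p
                           y , q = B-total n n∈ω
                       in y , proj₂ (spec y) q

  uniformisation⇒ACω : ∀ {ω X} → UniformisationOn ω X → ACω ω X
  uniformisation⇒ACω {ω} {X} unif A A-fun A-nonempty =
    let f , f-fun , f⊆B = unif B B-total in
    f , f-fun , λ n a x p q →
      let _ , _ , b , p′ , x∈b = ∈-relation⁻ ω X φ (f⊆B q) in
      ∈-≡ x∈b (function-unique A-fun p′ p)
    where
    φ : Formulaₜ 2
    φ = ∃ₜ ⟨ x₁ , x₀ ⟩ₜ ∈ₜ ` A ∧ₜ x₂ ∈ₜ x₀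

    B = ｛ ω ⨾ X ∣ φ ｝

    B-total : ∀ n → n ∈ ω → ∃[ x ] (x ∈ X × ⟨ n , x ⟩ ∈ B)
    B-total n n∈ω =
      let a , p = function-total A-fun n∈ω
          x , x∈a = A-nonempty n a p
          x∈X = to ∈-𝒫 (proj₂ (relation-∈ (proj₁ A-fun) p)) x x∈a
      in x , x∈X , ∈-relation⁺ ω X φ n∈ω x∈X (a , p , x∈a)

  -- Pull `B` back along `c`, choose there and compose with `c`. As `c` may be partial on `Y`, a
  -- surjection defined on a subset of `Y` will do.
  uniformisation-surjection : ∀ {ω Y Z} (c : V) →
    (∀ z → z ∈ Z → ∃[ y ] (y ∈ Y × ⟨ y , z ⟩ ∈ c)) →
    (∀ {y z z′} → ⟨ y , z ⟩ ∈ c → ⟨ y , z′ ⟩ ∈ c → z ≡ z′) →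
    UniformisationOn ω Y → UniformisationOn ω Z
  uniformisation-surjection {ω} {Y} {Z} c surjective functional unif B B-total =
    let g , g-fun , g⊆B′ = unif ｛ ω ⨾ Y ∣ φ ｝ λ n n∈ω →
          let z , z∈Z , p = B-total n n∈ω
              y , y∈Y , q = surjective z z∈Z
          in y , y∈Y , ∈-relation⁺ ω Y φ n∈ω y∈Y (z , z∈Z , q , p)
        ψ = ∃ₜ ⟨ x₁ , x₀ ⟩ₜ ∈ₜ ` g ∧ₜ ⟨ x₀ , x₂ ⟩ₜ ∈ₜ ` c
        value = λ {n} {z} (p : ⟨ n , z ⟩ ∈ ｛ ω ⨾ Z ∣ ψ ｝) → proj₂ (proj₂ (∈-relation⁻ ω Z ψ p))
    in ｛ ω ⨾ Z ∣ ψ ｝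
     , isFunction (relation-isRelation ω Z ψ)
         (λ n n∈ω →
           let y , p = function-total g-fun n∈ω
               _ , _ , z , z∈Z , q , _ = ∈-relation⁻ ω Y φ (g⊆B′ p)
           in z , ∈-relation⁺ ω Z ψ n∈ω z∈Z (y , p , q))
         (λ p p′ →
           let y , q , r = value p
               y′ , q′ , r′ = value p′
           in functional r (subst (λ y → ⟨ y , _ ⟩ ∈ c) (function-unique g-fun q′ q) r′))
     , λ p →
         let y , q , r = value p
             _ , _ , z′ , _ , r′ , s = ∈-relation⁻ ω Y φ (g⊆B′ q)
         in subst (λ z → ⟨ _ , z ⟩ ∈ B) (functional r′ r) s
    where
    φ : Formulaₜ 2
    φ = ∃ₜ x₀ ∈ₜ ` Z ∧ₜ ⟨ x₂ , x₀ ⟩ₜ ∈ₜ ` c ∧ₜ ⟨ x₁ , x₀ ⟩ₜ ∈ₜ ` B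

  -- Induction and the order of ω

  module Naturals {ω : V} (isω : Isω ω) where

    ∅ : V
    ∅ = proj₁ (proj₁ (proj₁ isω))

    ∉∅ : ∀ {x} → ¬ x ∈ ∅
    ∉∅ x∈∅ = proj₁ (proj₂ (proj₁ (proj₁ isω))) (_ , x∈∅)

    ∅∈ω : ∅ ∈ ω
    ∅∈ω = proj₂ (proj₂ (proj₁ (proj₁ isω)))

    succ∈ω : ∀ {n} → n ∈ ω → succ n ∈ ω
    succ∈ω = proj₂ (proj₁ isω) _

    ∈-succ⁻ : ∀ {k n} → k ∈ succ n → k ∈ n ⊎ k ≡ n
    ∈-succ⁻ p with to (proj₂ (union _) _) p
    ... | y , y∈ , k∈y with ∈-pair⁻ y∈
    ... | inj₁ refl = inj₁ k∈y
    ... | inj₂ refl = inj₂ ([ id , id ]′ (∈-pair⁻ k∈y))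

    ∈-succ⁺ : ∀ {k n} → k ∈ n → k ∈ succ n
    ∈-succ⁺ k∈n = from (proj₂ (union _) _) (_ , ∈-pairˡ , k∈n)

    n∈succ : ∀ {n} → n ∈ succ n
    n∈succ = from (proj₂ (union _) _) (_ , ∈-pairʳ , ∈-pairˡ)

    induction : (φ : Formulaₜ 1) → ⟦ φ ⟧ (∅ ∷ []) →
                (∀ n → n ∈ ω → ⟦ φ ⟧ (n ∷ []) → ⟦ φ ⟧ (succ n ∷ [])) →
                ∀ n → n ∈ ω → ⟦ φ ⟧ (n ∷ [])
    induction φ base step n n∈ω = proj₂ (to (∈-｛∣｝ ω φ) (proj₂ isω ｛ ω ∣ φ ｝ isInductive n n∈ω))
      where
      isInductive : Inductive ｛ ω ∣ φ ｝
      isInductive = (∅ , (λ (_ , p) → ∉∅ p) , from (∈-｛∣｝ ω φ) (∅∈ω , base))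
                , λ k k∈ → let k∈ω , p = to (∈-｛∣｝ ω φ) k∈ in
                           from (∈-｛∣｝ ω φ) (succ∈ω k∈ω , step k k∈ω p)

    ∈ω-trans : ∀ {k n} → k ∈ n → n ∈ ω → k ∈ ω
    ∈ω-trans k∈n n∈ω = induction (∀ₜ x₀ ∈ₜ x₁ ⇒ₜ x₀ ∈ₜ ` ω)
      (λ k → ⊥-elim ∘ ∉∅)
      (λ n n∈ω ih k → [ ih k , (λ { refl → n∈ω }) ]′ ∘ ∈-succ⁻) _ n∈ω _ k∈n

    ∈-trans : ∀ {j k n} → n ∈ ω → j ∈ k → k ∈ n → j ∈ n
    ∈-trans n∈ω j∈k k∈n = induction (∀ₜ ∀ₜ x₀ ∈ₜ x₁ ⇒ₜ x₁ ∈ₜ x₂ ⇒ₜ x₀ ∈ₜ x₂)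
      (λ k j _ → ⊥-elim ∘ ∉∅)
      (λ n n∈ω ih k j j∈k → ∈-succ⁺ ∘ [ ih k j j∈k , (λ { refl → j∈k }) ]′ ∘ ∈-succ⁻)
      _ n∈ω _ _ j∈k k∈n

    succ-∈-or-≡ : ∀ {k n} → n ∈ ω → k ∈ n → succ k ∈ n ⊎ succ k ≡ n
    succ-∈-or-≡ n∈ω k∈n = induction (∀ₜ x₀ ∈ₜ x₁ ⇒ₜ succₜ x₀ ∈ₜ x₁ ∨ₜ succₜ x₀ ≡ₜ x₁)
      (λ k → ⊥-elim ∘ ∉∅)
      (λ n n∈ω ih k →
        [ (λ k∈n → inj₁ ([ ∈-succ⁺ , (λ { refl → n∈succ }) ]′ (ih k k∈n))) , (λ { refl → inj₂ refl }) ]′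
        ∘ ∈-succ⁻)
      _ n∈ω _ k∈n

    ∅-∈-or-≡ : ∀ {n} → n ∈ ω → ∅ ∈ n ⊎ ∅ ≡ n
    ∅-∈-or-≡ = induction (` ∅ ∈ₜ x₀ ∨ₜ ` ∅ ≡ₜ x₀) (inj₂ refl)
      (λ n _ → inj₁ ∘ [ ∈-succ⁺ , (λ { refl → n∈succ }) ]′) _

    trichotomy : ∀ {m n} → m ∈ ω → n ∈ ω → m ∈ n ⊎ m ≡ n ⊎ n ∈ m
    trichotomy m∈ω n∈ω = induction (∀ₜ x₀ ∈ₜ ` ω ⇒ₜ x₁ ∈ₜ x₀ ∨ₜ x₁ ≡ₜ x₀ ∨ₜ x₀ ∈ₜ x₁)
      (λ n n∈ω → [ inj₁ , inj₂ ∘ inj₁ ]′ (∅-∈-or-≡ n∈ω))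
      (λ m m∈ω ih n n∈ω →
        [ [ inj₁ , inj₂ ∘ inj₁ ]′ ∘ succ-∈-or-≡ n∈ω
        , inj₂ ∘ inj₂ ∘ [ (λ { refl → n∈succ }) , ∈-succ⁺ ]′ ]′ (ih n n∈ω))
      _ m∈ω _ n∈ω

    -- Foundation supplies an ∈-minimal element of the comprehension, and the elements of a natural
    -- number are again in ω.
    least : (φ : Formulaₜ 1) → ∀ {n} → n ∈ ω → ⟦ φ ⟧ (n ∷ []) →
            ∃[ m ] (m ∈ ω × ⟦ φ ⟧ (m ∷ []) × (∀ k → k ∈ m → ¬ ⟦ φ ⟧ (k ∷ [])))
    least φ n∈ω p =
      let m , m∈ , minimal = foundation ｛ ω ∣ φ ｝ (_ , from (∈-｛∣｝ ω φ) (n∈ω , p))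
          m∈ω , q = to (∈-｛∣｝ ω φ) m∈
      in m , m∈ω , q , λ k k∈m r → minimal k (from (∈-｛∣｝ ω φ) (∈ω-trans k∈m m∈ω , r)) k∈m

    n∉n : ∀ {n} → ¬ n ∈ n
    n∉n {n} n∈n with foundation ⟅ n , n ⟆ (n , ∈-pairˡ)
    ... | m , m∈ , minimal with [ id , id ]′ (∈-pair⁻ m∈)
    ... | refl = minimal n ∈-pairˡ n∈n

  -- Coding subsets of ω by points of a complete order

  -- Realised below by I = [0, 3] with w ↦ w/3 + 2 and w ↦ w/3.
  record BinarySystem : Set ℓ where
    field
      I ≤-graph : V
      G         : Bool → V

    infix 4 _⊑_
    _⊑_ : Rel V ℓ
    u ⊑ v = ⟨ u , v ⟩ ∈ ≤-graph

    field
      ⊑-refl    : ∀ {v} → v ∈ I → v ⊑ v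
      ⊑-trans   : ∀ {u v w} → u ⊑ v → v ⊑ w → u ⊑ w
      ⊑-antisym : ∀ {u v} → u ⊑ v → v ⊑ u → u ≡ v
      bottom    : ∃[ b ] (b ∈ I × (∀ {v} → v ∈ I → b ⊑ v))
      supremum  : ∀ S → S ⊆ I → Nonempty S →
                  ∃[ u ] (u ∈ I × (∀ v → v ∈ S → v ⊑ u) ×
                          (∀ b → b ∈ I → (∀ v → v ∈ S → v ⊑ b) → u ⊑ b))
      G-∈        : ∀ i {w v} → ⟨ w , v ⟩ ∈ G i → w ∈ I × v ∈ I
      G-total    : ∀ i {w} → w ∈ I → ∃[ v ] ⟨ w , v ⟩ ∈ G i
      G-monotone : ∀ i {w w′ v v′} → ⟨ w , v ⟩ ∈ G i → ⟨ w′ , v′ ⟩ ∈ G i → w ⊑ w′ → v ⊑ v′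
      G-injective : ∀ i {w w′ v} → ⟨ w , v ⟩ ∈ G i → ⟨ w′ , v ⟩ ∈ G i → w ≡ w′
      G-disjoint  : ∀ {w w′ v} → ⟨ w , v ⟩ ∈ G true → ⟨ w′ , v ⟩ ∈ G false → ⊥

  -- Each x ⊆ ω is coded by the r for which there is a sequence t with t₀ = r
  -- and tₙ = g(tₙ₊₁), where g is the first injection if n ∈ x and the second
  -- otherwise.
  module Coding {ω : V} (isω : Isω ω) (system : BinarySystem) where
    open Naturals isω
    open BinarySystem system

    stepₜ : Term n → Term n → Term n → Term n → Formulaₜ n
    stepₜ x k v w = (k ∈ₜ x ⇒ₜ ⟨ w , v ⟩ₜ ∈ₜ ` G true) ∧ₜ (¬ₜ k ∈ₜ x ⇒ₜ ⟨ w , v ⟩ₜ ∈ₜ ` G false)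

    Step : V → V → V → V → Set ℓ
    Step x k v w = (k ∈ x → ⟨ w , v ⟩ ∈ G true) × (¬ k ∈ x → ⟨ w , v ⟩ ∈ G false)

    -- For fixed `x` and `k` the relation `Step` is one of the two graphs, so totality and
    -- monotonicity of `G` carry over to it.
    stepsBy : ∀ x k → ∃[ i ] (∀ {v w} → Step x k v w ⇔ ⟨ w , v ⟩ ∈ G i)
    stepsBy x k with em (` k ∈ₜ ` x)
    ... | yes k∈x = true  , mk⇔ (λ s → proj₁ s k∈x) (λ p → (λ _ → p) , (λ k∉x → ⊥-elim (k∉x k∈x)))
    ... | no  k∉x = false , mk⇔ (λ s → proj₂ s k∉x) (λ p → (λ k∈x → ⊥-elim (k∉x k∈x)) , (λ _ → p))

    step-∈ : ∀ {x k v w} → Step x k v w → w ∈ I × v ∈ I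
    step-∈ {x} {k} s = let i , eq = stepsBy x k in G-∈ i (to eq s)

    step-total : ∀ x k {w} → w ∈ I → ∃[ v ] Step x k v w
    step-total x k w∈I = let i , eq = stepsBy x k ; v , p = G-total i w∈I in v , from eq p

    step-monotone : ∀ {x k v v′ w w′} → Step x k v w → Step x k v′ w′ → w ⊑ w′ → v ⊑ v′
    step-monotone {x} {k} s s′ = let i , eq = stepsBy x k in G-monotone i (to eq s) (to eq s′)

    step-injective : ∀ {x y k v w w′} → Step x k v w → Step y k v w′ → (k ∈ x → k ∈ y) × w ≡ w′
    step-injective {x} {y} {k} s s′ with em (` k ∈ₜ ` x) | em (` k ∈ₜ ` y)
    ... | yes p | yes q = (λ _ → q) , G-injective true (proj₁ s p) (proj₁ s′ q)
    ... | yes p | no  q = ⊥-elim (G-disjoint (proj₁ s p) (proj₂ s′ q))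
    ... | no  p | yes q = ⊥-elim (G-disjoint (proj₁ s′ q) (proj₂ s p))
    ... | no  p | no  q = (λ r → ⊥-elim (p r)) , G-injective false (proj₂ s p) (proj₂ s′ q)

    -- The sequence t is the greatest solution of t ⊑ g(t), which exists by the
    -- Knaster–Tarski argument: tₙ is the supremum of all v such that ⟨ n , v ⟩
    -- lies in some s with Post s.
    module Code (x : V) where

      Post : V → Set ℓ
      Post s = ∀ k v → ⟨ k , v ⟩ ∈ s →
               ∃[ w ] ∃[ u ] (⟨ succ k , w ⟩ ∈ s × Step x k u w × v ⊑ u)

      φW φ⊥ φT φU : Formulaₜ 2
      φW = ∃ₜ (∀ₜ ∀ₜ ⟨ x₁ , x₀ ⟩ₜ ∈ₜ x₂ ⇒ₜ
               (∃ₜ ∃ₜ ⟨ succₜ x₃ , x₁ ⟩ₜ ∈ₜ x₄ ∧ₜ stepₜ (` x) x₃ x₀ x₁ ∧ₜ ⟨ x₂ , x₀ ⟩ₜ ∈ₜ ` ≤-graph))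
              ∧ₜ ⟨ x₁ , x₂ ⟩ₜ ∈ₜ x₀
      φ⊥ = x₁ ≡ₜ ` proj₁ bottom

      W ⊥s : V
      W  = ｛ ω ⨾ I ∣ φW ｝
      ⊥s = ｛ ω ⨾ I ∣ φ⊥ ｝

      φT = (∀ₜ ⟨ x₁ , x₀ ⟩ₜ ∈ₜ ` W ⇒ₜ ⟨ x₀ , x₂ ⟩ₜ ∈ₜ ` ≤-graph) ∧ₜ
           (∀ₜ x₀ ∈ₜ ` I ⇒ₜ (∀ₜ ⟨ x₂ , x₀ ⟩ₜ ∈ₜ ` W ⇒ₜ ⟨ x₀ , x₁ ⟩ₜ ∈ₜ ` ≤-graph) ⇒ₜ
               ⟨ x₂ , x₀ ⟩ₜ ∈ₜ ` ≤-graph)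

      T : V
      T = ｛ ω ⨾ I ∣ φT ｝

      φU = ∃ₜ ∃ₜ ⟨ succₜ x₂ , x₁ ⟩ₜ ∈ₜ ` T ∧ₜ stepₜ (` x) x₂ x₀ x₁ ∧ₜ ⟨ x₃ , x₀ ⟩ₜ ∈ₜ ` ≤-graph

      U : V
      U = ｛ ω ⨾ I ∣ φU ｝

      post⇒W : ∀ {s k v} → Post s → k ∈ ω → v ∈ I → ⟨ k , v ⟩ ∈ s → ⟨ k , v ⟩ ∈ W
      post⇒W post k∈ω v∈I p = ∈-relation⁺ ω I φW k∈ω v∈I (_ , post , p)

      post-W : Post W
      post-W k v p =
        let k∈ω , v∈I , s , post , q = ∈-relation⁻ ω I φW p
            w , u , r , step , v⊑u   = post k v q
        in w , u , post⇒W post (succ∈ω k∈ω) (proj₁ (step-∈ step)) r , step , v⊑u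

      -- The constant bottom sequence makes every section of `W` nonempty, as `supremum` demands.
      post-⊥s : Post ⊥s
      post-⊥s k v p =
        let b , b∈I , b⊑ = bottom
            k∈ω , _ , v≡b = ∈-relation⁻ ω I φ⊥ p
            u , step = step-total x k b∈I
        in b , u , ∈-relation⁺ ω I φ⊥ (succ∈ω k∈ω) b∈I refl , step
         , subst (_⊑ u) (sym v≡b) (b⊑ (proj₂ (step-∈ step)))

      T-total : ∀ {k} → k ∈ ω → ∃[ v ] ⟨ k , v ⟩ ∈ T
      T-total {k} k∈ω =
        let b , b∈I , _ = bottom
            u , u∈I , upper , least-upper = supremum ｛ I ∣ φ ｝ (λ v → proj₁ ∘ to (∈-｛∣｝ I φ))
              (b , ∈fibre (post⇒W post-⊥s k∈ω b∈I (∈-relation⁺ ω I φ⊥ k∈ω b∈I refl)))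
        in u , ∈-relation⁺ ω I φT k∈ω u∈I
                 ( (λ v → upper v ∘ ∈fibre)
                 , (λ c c∈I c-upper → least-upper c c∈I λ v → c-upper v ∘ proj₂ ∘ to (∈-｛∣｝ I φ)))
        where
        φ = ⟨ ` k , x₀ ⟩ₜ ∈ₜ ` W
        ∈fibre : ∀ {v} → ⟨ k , v ⟩ ∈ W → v ∈ ｛ I ∣ φ ｝
        ∈fibre p = from (∈-｛∣｝ I φ) (proj₁ (proj₂ (∈-relation⁻ ω I φW p)) , p)

      T-upper : ∀ {k v u} → ⟨ k , u ⟩ ∈ T → ⟨ k , v ⟩ ∈ W → v ⊑ u
      T-upper p = proj₁ (proj₂ (proj₂ (∈-relation⁻ ω I φT p))) _

      -- One half of the fixed point equation, T(k) ⊑ g(T(k+1)): by monotonicity the right side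
      -- bounds all `v` with `⟨ k , v ⟩` in `W`, and `T` takes least upper bounds.
      T⊆U : ∀ {k v} → ⟨ k , v ⟩ ∈ T → ⟨ k , v ⟩ ∈ U
      T⊆U {k} p =
        let k∈ω , v∈I , _ , least-upper = ∈-relation⁻ ω I φT p
            w , q = T-total (succ∈ω k∈ω)
            u , step = step-total x k (proj₁ (proj₂ (∈-relation⁻ ω I φT q)))
            u∈I = proj₂ (step-∈ step)
        in ∈-relation⁺ ω I φU k∈ω v∈I (w , u , q , step , least-upper u u∈I λ v r →
             let w′ , u′ , q′ , step′ , v⊑u′ = post-W k v r in
             ⊑-trans v⊑u′ (step-monotone step′ step (T-upper q q′)))

      -- The other half: `U` collects what lies below g(T(k+1)), that value included. Being `Post`,
      -- it is part of `W` and hence bounded by `T`.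
      post-U : Post U
      post-U k v p =
        let _ , _ , w , u , q , step , v⊑u = ∈-relation⁻ ω I φU p in
        w , u , T⊆U q , step , v⊑u

      T-step : ∀ {k v} → ⟨ k , v ⟩ ∈ T → ∃[ w ] (⟨ succ k , w ⟩ ∈ T × Step x k v w)
      T-step {k} p =
        let k∈ω , _ , w , u , q , step , v⊑u = ∈-relation⁻ ω I φU (T⊆U p)
            u∈I = proj₂ (step-∈ step)
            u∈U = ∈-relation⁺ ω I φU k∈ω u∈I (w , u , q , step , ⊑-refl u∈I)
            u⊑v = T-upper p (post⇒W post-U k∈ω u∈I u∈U)
        in w , q , subst (λ v → Step x k v w) (⊑-antisym u⊑v v⊑u) step

    φc : Formulaₜ 2
    φc = ∃ₜ ⟨ ` ∅ , x₁ ⟩ₜ ∈ₜ x₀ ∧ₜ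
         (∀ₜ ∀ₜ ⟨ x₁ , x₀ ⟩ₜ ∈ₜ x₂ ⇒ₜ (∃ₜ ⟨ succₜ x₂ , x₀ ⟩ₜ ∈ₜ x₃ ∧ₜ stepₜ x₅ x₂ x₁ x₀))

    codes : V
    codes = ｛ I ⨾ 𝒫 ω ∣ φc ｝

    Trajectory : V → V → Set ℓ
    Trajectory x t = ∀ k v → ⟨ k , v ⟩ ∈ t → ∃[ w ] (⟨ succ k , w ⟩ ∈ t × Step x k v w)

    ∈-codes⁺ : ∀ {r x t} → r ∈ I → x ∈ 𝒫 ω → ⟨ ∅ , r ⟩ ∈ t → Trajectory x t → ⟨ r , x ⟩ ∈ codes
    ∈-codes⁺ r∈I x∈𝒫ω p t-step = ∈-relation⁺ I (𝒫 ω) φc r∈I x∈𝒫ω (_ , p , t-step)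

    ∈-codes⁻ : ∀ {r x} → ⟨ r , x ⟩ ∈ codes → x ∈ 𝒫 ω × ∃[ t ] (⟨ ∅ , r ⟩ ∈ t × Trajectory x t)
    ∈-codes⁻ p = proj₂ (∈-relation⁻ I (𝒫 ω) φc p)

    codes-surjective : ∀ x → x ∈ 𝒫 ω → ∃[ r ] (r ∈ I × ⟨ r , x ⟩ ∈ codes)
    codes-surjective x x∈𝒫ω =
      let r , p = T-total ∅∈ω
          r∈I = proj₂ (relation-∈ (relation-isRelation ω I φT) p)
      in r , r∈I , ∈-codes⁺ r∈I x∈𝒫ω p (λ k v → T-step)
      where open Code x

    -- The sets `s` and `t` may be multivalued, so only a common point is carried along. Since the
    -- two maps are injective with disjoint ranges, this point determines both whether `k` is in the
    -- coded set and the next common point.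
    trajectory-⊆ : ∀ {r x y s t} → Trajectory x s → Trajectory y t →
                   ⟨ ∅ , r ⟩ ∈ s → ⟨ ∅ , r ⟩ ∈ t → ∀ k → k ∈ ω → k ∈ x → k ∈ y
    trajectory-⊆ {r} {x} {y} {s} {t} s-step t-step r∈s r∈t k k∈ω =
      let v , v∈s , v∈t = induction (∃ₜ ⟨ x₁ , x₀ ⟩ₜ ∈ₜ ` s ∧ₜ ⟨ x₁ , x₀ ⟩ₜ ∈ₜ ` t)
                            (r , r∈s , r∈t) next k k∈ω
          _ , _ , step  = s-step k v v∈s
          _ , _ , step′ = t-step k v v∈t
      in proj₁ (step-injective step step′)
      where
      next : ∀ k → k ∈ ω → ∃[ v ] (⟨ k , v ⟩ ∈ s × ⟨ k , v ⟩ ∈ t) →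
             ∃[ v ] (⟨ succ k , v ⟩ ∈ s × ⟨ succ k , v ⟩ ∈ t)
      next k _ (v , v∈s , v∈t) with s-step k v v∈s | t-step k v v∈t
      ... | w , w∈s , step | _ , w∈t , step′ with proj₂ (step-injective step step′)
      ... | refl = w , w∈s , w∈t

    codes-functional : ∀ {r x y} → ⟨ r , x ⟩ ∈ codes → ⟨ r , y ⟩ ∈ codes → x ≡ y
    codes-functional p q =
      let x∈𝒫ω , s , r∈s , s-step = ∈-codes⁻ p
          y∈𝒫ω , t , r∈t , t-step = ∈-codes⁻ q
      in ⊆-antisym (λ k k∈x → trajectory-⊆ s-step t-step r∈s r∈t k (to ∈-𝒫 x∈𝒫ω k k∈x) k∈x)
                   (λ k k∈y → trajectory-⊆ t-step s-step r∈t r∈s k (to ∈-𝒫 y∈𝒫ω k k∈y) k∈y)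

    uniformisation-𝒫ω : ∀ {Y} → I ⊆ Y → UniformisationOn ω Y → UniformisationOn ω (𝒫 ω)
    uniformisation-𝒫ω I⊆Y = uniformisation-surjection codes
      (λ x x∈𝒫ω → let r , r∈I , p = codes-surjective x x∈𝒫ω in r , I⊆Y r r∈I , p)
      codes-functional

  -- The binary system on the interval [0, 3] of the reals

  module _ {ℝ : V} (isReals : IsReals ℝ) where
    open IsReals isReals
    open OrderedField isCommutativeRing 0≉1 inverse isStrictTotalOrder +-mono-< *-pos
      using (2#; 3#; InInterval; Contraction; ≤-trans; 0≤2; 0≤3; ≤-antisym; contraction-total;
             contraction-monotone; contraction-injective; contraction-disjoint)

    φI : Formulaₜ 1
    φI = (⟨ ` proj₁ 0# , x₀ ⟩ₜ ∈ₜ ` lt ∨ₜ ` proj₁ 0# ≡ₜ x₀) ∧ₜ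
         (⟨ x₀ , ` proj₁ 3# ⟩ₜ ∈ₜ ` lt ∨ₜ x₀ ≡ₜ ` proj₁ 3#)

    φ≤ : Formulaₜ 2
    φ≤ = ⟨ x₀ , x₁ ⟩ₜ ∈ₜ ` lt ∨ₜ x₀ ≡ₜ x₁

    -- v = w/3 + d, with x₁ = w/3 and x₀ = 2w/3 under the quantifiers.
    φG : El ℝ → Formulaₜ 2
    φG d = ∃ₜ ∃ₜ ⟨ ⟨ x₁ , x₁ ⟩ₜ , x₀ ⟩ₜ ∈ₜ ` add ∧ₜ ⟨ ⟨ x₀ , x₁ ⟩ₜ , x₂ ⟩ₜ ∈ₜ ` add ∧ₜ
                 ⟨ ⟨ x₁ , ` proj₁ d ⟩ₜ , x₃ ⟩ₜ ∈ₜ ` add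

    interval : V
    interval = ｛ ℝ ∣ φI ｝

    ∈-interval : ∀ {v} → v ∈ interval ⇔ (∃[ v∈ℝ ] InInterval (v , v∈ℝ))
    ∈-interval = ∈-｛∣｝ ℝ φI

    interval⇒ℝ : El interval → El ℝ
    interval⇒ℝ (v , v∈I) = v , proj₁ (to ∈-interval v∈I)

    inInterval : (v : El interval) → InInterval (interval⇒ℝ v)
    inInterval (v , v∈I) = proj₂ (to ∈-interval v∈I)

    add-graph⁺ : (x y z : El ℝ) → (x + y) ≈ z → ⟨ ⟨ proj₁ x , proj₁ y ⟩ , proj₁ z ⟩ ∈ add
    add-graph⁺ x y z x+y≈z = subst (λ z → ⟨ ⟨ proj₁ x , proj₁ y ⟩ , z ⟩ ∈ add) x+y≈z
                               (proj₁ (proj₂ (IsOperation.value isAdd x y)))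

    add-graph⁻ : (x y z : El ℝ) → ⟨ ⟨ proj₁ x , proj₁ y ⟩ , proj₁ z ⟩ ∈ add → (x + y) ≈ z
    add-graph⁻ x y z = proj₂ (proj₂ (IsOperation.value isAdd x y)) {z}

    add-∈ : ∀ {x y z} → ⟨ ⟨ x , y ⟩ , z ⟩ ∈ add → x ∈ ℝ × z ∈ ℝ
    add-∈ p with IsOperation.graph isAdd _ p
    ... | _ , _ , _ , x∈ , _ , z∈ , e
      with ⟨⟩-injectiveˡ (⟨⟩-injectiveˡ e) | ⟨⟩-injectiveʳ e
    ... | refl | refl = x∈ , z∈

    ContractionGraph : El ℝ → V
    ContractionGraph d = ｛ interval ⨾ interval ∣ φG d ｝

    contraction⁺ : ∀ d (w v : El interval) → Contraction d (interval⇒ℝ w) (interval⇒ℝ v) →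
                   ⟨ proj₁ w , proj₁ v ⟩ ∈ ContractionGraph d
    contraction⁺ d w v (y , 3y≈w , y+d≈v) = ∈-relation⁺ interval interval (φG d) (proj₂ w) (proj₂ v)
      ( proj₁ y , proj₁ (y + y) , add-graph⁺ y y (y + y) refl
      , add-graph⁺ (y + y) y (interval⇒ℝ w) 3y≈w , add-graph⁺ y d (interval⇒ℝ v) y+d≈v )

    contraction⁻ : ∀ d {w v} → ⟨ w , v ⟩ ∈ ContractionGraph d →
                   ∃[ w∈I ] ∃[ v∈I ] Contraction d (interval⇒ℝ (w , w∈I)) (interval⇒ℝ (v , v∈I))
    contraction⁻ d {w} {v} p =
      let w∈I , v∈I , y , s , p₁ , p₂ , p₃ = ∈-relation⁻ interval interval (φG d) p
          y∈ , s∈ = add-∈ p₁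
          ŷ = y , y∈
          ŵ = interval⇒ℝ (w , w∈I)
          y+y≈s = add-graph⁻ ŷ ŷ (s , s∈) p₁
      in w∈I , v∈I , ŷ
       , add-graph⁻ (ŷ + ŷ) ŷ ŵ (subst (λ s → ⟨ ⟨ s , y ⟩ , w ⟩ ∈ add) (sym y+y≈s) p₂)
       , add-graph⁻ ŷ d (interval⇒ℝ (v , v∈I)) p₃

    ≤-relation : V
    ≤-relation = ｛ interval ⨾ interval ∣ φ≤ ｝

    ≤-relation⁺ : (u v : El interval) → interval⇒ℝ u ≤ interval⇒ℝ v →
                  ⟨ proj₁ u , proj₁ v ⟩ ∈ ≤-relation
    ≤-relation⁺ u v = ∈-relation⁺ interval interval φ≤ (proj₂ u) (proj₂ v)

    ≤-relation⁻ : ∀ {u v} → ⟨ u , v ⟩ ∈ ≤-relation →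
                  ∃[ u∈I ] ∃[ v∈I ] interval⇒ℝ (u , u∈I) ≤ interval⇒ℝ (v , v∈I)
    ≤-relation⁻ = ∈-relation⁻ interval interval φ≤

    offset : Bool → El ℝ
    offset true  = 2#
    offset false = 0#

    offset-bounds : ∀ i → 0# ≤ offset i × offset i ≤ 2#
    offset-bounds true  = 0≤2 , inj₂ refl
    offset-bounds false = inj₂ refl , 0≤2

    ⊑-trans : ∀ {u v w} → ⟨ u , v ⟩ ∈ ≤-relation → ⟨ v , w ⟩ ∈ ≤-relation → ⟨ u , w ⟩ ∈ ≤-relation
    ⊑-trans p q =
      let u∈I , v∈I , u≤v = ≤-relation⁻ p
          _   , w∈I , v≤w = ≤-relation⁻ q
          u = interval⇒ℝ (_ , u∈I) ; v = interval⇒ℝ (_ , v∈I) ; w = interval⇒ℝ (_ , w∈I)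
      in ≤-relation⁺ (_ , u∈I) (_ , w∈I) (≤-trans {u} {v} {w} u≤v v≤w)

    ⊑-antisym : ∀ {u v} → ⟨ u , v ⟩ ∈ ≤-relation → ⟨ v , u ⟩ ∈ ≤-relation → u ≡ v
    ⊑-antisym p q =
      let u∈I , v∈I , u≤v = ≤-relation⁻ p
          _   , _   , v≤u = ≤-relation⁻ q
      in ≤-antisym {interval⇒ℝ (_ , u∈I)} {interval⇒ℝ (_ , v∈I)} u≤v v≤u

    interval-bottom : ∃[ b ] (b ∈ interval × (∀ {v} → v ∈ interval → ⟨ b , v ⟩ ∈ ≤-relation))
    interval-bottom =
      let 0∈I = from ∈-interval (proj₂ 0# , inj₂ refl , 0≤3) in
      proj₁ 0# , 0∈I , λ v∈I → ≤-relation⁺ (_ , 0∈I) (_ , v∈I) (proj₁ (inInterval (_ , v∈I)))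

    interval-supremum : ∀ S → S ⊆ interval → Nonempty S →
      ∃[ u ] (u ∈ interval × (∀ v → v ∈ S → ⟨ v , u ⟩ ∈ ≤-relation) ×
              (∀ b → b ∈ interval → (∀ v → v ∈ S → ⟨ v , b ⟩ ∈ ≤-relation) → ⟨ u , b ⟩ ∈ ≤-relation))
    interval-supremum S S⊆I (s , s∈S) =
      let u , upper , least-upper =
            complete S (λ v → proj₁ ∘ to ∈-interval ∘ S⊆I v) (s , s∈S)
              (3# , λ v v∈S → proj₂ (inInterval (_ , S⊆I _ v∈S)))
          ŝ = interval⇒ℝ (s , S⊆I s s∈S)
          0≤s , _ = inInterval (s , S⊆I s s∈S)
          u∈I = from ∈-interval
            ( proj₂ u
            -- The given element of `S` keeps the supremum at or above 0.
            , ≤-trans {0#} {ŝ} {u} 0≤s (upper ŝ s∈S)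
            , least-upper 3# λ v v∈S → proj₂ (inInterval (_ , S⊆I _ v∈S)) )
      in proj₁ u , u∈I
       , (λ v v∈S → let v∈I = S⊆I v v∈S in
            ≤-relation⁺ (v , v∈I) (_ , u∈I) (upper (interval⇒ℝ (v , v∈I)) v∈S))
       , (λ b b∈I b-upper → ≤-relation⁺ (_ , u∈I) (b , b∈I)
            (least-upper (interval⇒ℝ (b , b∈I)) λ v v∈S → proj₂ (proj₂ (≤-relation⁻ (b-upper _ v∈S)))))

    realBinarySystem : BinarySystem
    realBinarySystem = record
      { I           = interval
      ; ≤-graph     = ≤-relation
      ; G           = λ i → ContractionGraph (offset i)
      ; ⊑-refl      = λ v∈I → ≤-relation⁺ (_ , v∈I) (_ , v∈I) (inj₂ refl)
      ; ⊑-trans     = ⊑-trans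
      ; ⊑-antisym   = ⊑-antisym
      ; bottom      = interval-bottom
      ; supremum    = interval-supremum
      ; G-∈         = λ i p → let w∈I , v∈I , _ = contraction⁻ (offset i) p in w∈I , v∈I
      ; G-total     = λ i w∈I →
          let 0≤d , d≤2 = offset-bounds i
              ŵ = interval⇒ℝ (_ , w∈I)
              v , v∈ , c = contraction-total (offset i) ŵ 0≤d d≤2 (inInterval (_ , w∈I))
          in proj₁ v , contraction⁺ (offset i) (_ , w∈I) (_ , from ∈-interval (proj₂ v , v∈)) c
      ; G-monotone  = λ i p p′ w⊑w′ →
          let w∈I  , v∈I  , c  = contraction⁻ (offset i) p
              w′∈I , v′∈I , c′ = contraction⁻ (offset i) p′
              _ , _ , w≤w′ = ≤-relation⁻ w⊑w′
          in ≤-relation⁺ (_ , v∈I) (_ , v′∈I)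
               (contraction-monotone (offset i) (interval⇒ℝ (_ , w∈I)) (interval⇒ℝ (_ , w′∈I))
                 (interval⇒ℝ (_ , v∈I)) (interval⇒ℝ (_ , v′∈I)) c c′ w≤w′)
      ; G-injective = λ i p p′ →
          let w∈I  , v∈I , c  = contraction⁻ (offset i) p
              w′∈I , _   , c′ = contraction⁻ (offset i) p′
          in contraction-injective (offset i) (interval⇒ℝ (_ , w∈I)) (interval⇒ℝ (_ , w′∈I))
               (interval⇒ℝ (_ , v∈I)) c c′
      ; G-disjoint  = λ p p′ →
          let w∈I  , v∈I , c  = contraction⁻ 2# p
              w′∈I , _   , c′ = contraction⁻ 0# p′
          in contraction-disjoint (interval⇒ℝ (_ , w∈I)) (interval⇒ℝ (_ , w′∈I))
               (interval⇒ℝ (_ , v∈I)) (inInterval (_ , w∈I)) (inInterval (_ , w′∈I)) c c′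
      }

    uniformisation-ℝ⇒𝒫ω : ∀ {ω} → Isω ω → UniformisationOn ω ℝ → UniformisationOn ω (𝒫 ω)
    uniformisation-ℝ⇒𝒫ω isω = uniformisation-𝒫ω (λ _ → proj₁ ∘ to ∈-interval)
      where open Coding isω realBinarySystem

  -- From a total relation to a coherent one

  module _ {ω X : V} (isω : Isω ω) where
    open Naturals isω

    IsTotal : V → Set ℓ
    IsTotal D = ∀ n → n ∈ ω → ∃[ y ] (y ∈ X × ⟨ n , y ⟩ ∈ D)

    -- The sections of a coherent relation are pairwise equal or disjoint.
    IsCoherent : V → Set ℓ
    IsCoherent E = ∀ {m n y z} → ⟨ n , y ⟩ ∈ E → ⟨ m , y ⟩ ∈ E → ⟨ n , z ⟩ ∈ E → ⟨ m , z ⟩ ∈ E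

    -- Choose for each n one of the sets { k ∣ ⟨ k , y ⟩ ∈ D } with ⟨ n , y ⟩ ∈ D,
    -- and keep the y that give this set.
    coherentRefinement : UniformisationOn ω (𝒫 ω) → ∀ D → IsTotal D →
      ∃[ E ] ((∀ {n y} → ⟨ n , y ⟩ ∈ E → ⟨ n , y ⟩ ∈ D) × IsTotal E × IsCoherent E)
    coherentRefinement unif D D-total = E , E⊆D , E-total , E-coherent
      where
      indexSetₜ : Term (suc n) → Term (suc n) → Formulaₜ n
      indexSetₜ x y = ∀ₜ x₀ ∈ₜ ` ω ⇒ₜ (x₀ ∈ₜ x ⇔ₜ ⟨ x₀ , y ⟩ₜ ∈ₜ ` D)

      IndexSet : V → V → Set ℓ
      IndexSet x y = ∀ k → k ∈ ω → (k ∈ x → ⟨ k , y ⟩ ∈ D) × (⟨ k , y ⟩ ∈ D → k ∈ x)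

      φB : Formulaₜ 2
      φB = ∃ₜ x₀ ∈ₜ ` X ∧ₜ ⟨ x₁ , x₀ ⟩ₜ ∈ₜ ` D ∧ₜ indexSetₜ x₃ x₁

      B : V
      B = ｛ ω ⨾ 𝒫 ω ∣ φB ｝

      B-total : ∀ n → n ∈ ω → ∃[ x ] (x ∈ 𝒫 ω × ⟨ n , x ⟩ ∈ B)
      B-total n n∈ω =
        let y , y∈X , p = D-total n n∈ω
            φ = ⟨ x₀ , ` y ⟩ₜ ∈ₜ ` D
            x∈𝒫ω = from ∈-𝒫 λ k → proj₁ ∘ to (∈-｛∣｝ ω φ)
        in ｛ ω ∣ φ ｝ , x∈𝒫ω , ∈-relation⁺ ω (𝒫 ω) φB n∈ω x∈𝒫ω
             (y , y∈X , p , λ k k∈ω → proj₂ ∘ to (∈-｛∣｝ ω φ) , λ q → from (∈-｛∣｝ ω φ) (k∈ω , q))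

      f : V
      f = proj₁ (unif B B-total)

      f-fun : IsFunction f ω (𝒫 ω)
      f-fun = proj₁ (proj₂ (unif B B-total))

      f-value : ∀ {n x} → ⟨ n , x ⟩ ∈ f →
                n ∈ ω × x ∈ 𝒫 ω × ∃[ y ] (y ∈ X × ⟨ n , y ⟩ ∈ D × IndexSet x y)
      f-value p = ∈-relation⁻ ω (𝒫 ω) φB (proj₂ (proj₂ (unif B B-total)) p)

      φE : Formulaₜ 2
      φE = ∃ₜ ⟨ x₁ , x₀ ⟩ₜ ∈ₜ ` f ∧ₜ indexSetₜ x₁ x₃

      E : V
      E = ｛ ω ⨾ X ∣ φE ｝

      E⁺ : ∀ {n x y} → ⟨ n , x ⟩ ∈ f → y ∈ X → IndexSet x y → ⟨ n , y ⟩ ∈ E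
      E⁺ p y∈X i = ∈-relation⁺ ω X φE (proj₁ (f-value p)) y∈X (_ , p , i)

      E⁻ : ∀ {n y} → ⟨ n , y ⟩ ∈ E → y ∈ X × ∃[ x ] (⟨ n , x ⟩ ∈ f × IndexSet x y)
      E⁻ p = proj₂ (∈-relation⁻ ω X φE p)

      -- The set chosen for `n` is the index set of some point related to `n` by `D`, so it contains
      -- `n`; every other point with this index set is then related to `n` as well.
      E⊆D : ∀ {n y} → ⟨ n , y ⟩ ∈ E → ⟨ n , y ⟩ ∈ D
      E⊆D {n} p =
        let _ , x , q , i = E⁻ p
            n∈ω , _ , _ , _ , r , j = f-value q
        in proj₁ (i n n∈ω) (proj₂ (j n n∈ω) r)

      E-total : IsTotal E
      E-total n n∈ω =
        let x , p = function-total f-fun n∈ω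
            _ , _ , y , y∈X , _ , i = f-value p
        in y , y∈X , E⁺ p y∈X i

      indexSet-⊆ : ∀ {n x x′ y} → ⟨ n , x ⟩ ∈ f → IndexSet x y → IndexSet x′ y → x ⊆ x′
      indexSet-⊆ p i i′ k k∈x =
        let k∈ω = to ∈-𝒫 (proj₁ (proj₂ (f-value p))) k k∈x in proj₂ (i′ k k∈ω) (proj₁ (i k k∈ω) k∈x)

      -- A common point of two sections has one index set, which is the set chosen for both indices;
      -- and a section is determined by its chosen set.
      E-coherent : IsCoherent E
      E-coherent {z = z} p q r =
        let _   , x  , x∈f  , i = E⁻ p
            _   , x′ , x′∈f , j = E⁻ q
            z∈X , x″ , x″∈f , k = E⁻ r
            x≡x′ = ⊆-antisym (indexSet-⊆ x∈f i j) (indexSet-⊆ x′∈f j i)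
            x″≡x = function-unique f-fun x″∈f x∈f
        in E⁺ x′∈f z∈X (subst (λ x → IndexSet x z) (trans x″≡x x≡x′) k)

    -- Least indices of classes and the relation given to dependent choice

    module FirstIndex (E : V) (E-total : IsTotal E) (E-coherent : IsCoherent E) where

      φF : Formulaₜ 2
      φF = ⟨ x₀ , x₁ ⟩ₜ ∈ₜ ` E ∧ₜ (∀ₜ x₀ ∈ₜ x₁ ⇒ₜ ¬ₜ ⟨ x₀ , x₂ ⟩ₜ ∈ₜ ` E)

      F : V
      F = ｛ ω ⨾ X ∣ φF ｝

      F⁻ : ∀ {n y} → ⟨ n , y ⟩ ∈ F →
           n ∈ ω × y ∈ X × ⟨ n , y ⟩ ∈ E × (∀ j → j ∈ n → ¬ ⟨ j , y ⟩ ∈ E)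
      F⁻ p = ∈-relation⁻ ω X φF p

      firstIndex : ∀ {n y} → n ∈ ω → y ∈ X → ⟨ n , y ⟩ ∈ E → ∃[ m ] ⟨ m , y ⟩ ∈ F
      firstIndex {y = y} n∈ω y∈X p =
        let m , m∈ω , q , first = least (⟨ x₀ , ` y ⟩ₜ ∈ₜ ` E) n∈ω p in
        m , ∈-relation⁺ ω X φF m∈ω y∈X (q , first)

      firstIndex-unique : ∀ {m n y z} → ⟨ m , y ⟩ ∈ F → ⟨ n , z ⟩ ∈ F →
                          ⟨ n , y ⟩ ∈ E → ⟨ m , z ⟩ ∈ E → m ≡ n
      firstIndex-unique p q p′ q′ with F⁻ p | F⁻ q
      ... | m∈ω , _ , _ , m-first | n∈ω , _ , _ , n-first with trichotomy m∈ω n∈ω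
      ... | inj₁ m∈n        = ⊥-elim (n-first _ m∈n q′)
      ... | inj₂ (inj₁ m≡n) = m≡n
      ... | inj₂ (inj₂ n∈m) = ⊥-elim (m-first _ n∈m p′)

      IsFirst : V → Set ℓ
      IsFirst n = ∃[ y ] ⟨ n , y ⟩ ∈ F

      PartialChoice : V → Set ℓ
      PartialChoice p = (∀ n y → ⟨ n , y ⟩ ∈ p → ⟨ n , y ⟩ ∈ F) ×
                        (∀ n y z → ⟨ n , y ⟩ ∈ p → ⟨ n , z ⟩ ∈ p → y ≡ z)

      ChoosesBelow : V → V → Set ℓ
      ChoosesBelow p n = ∀ j → j ∈ n → IsFirst j → ∃[ y ] ⟨ j , y ⟩ ∈ p

      finiteChoice : ∀ n → n ∈ ω → ∃[ p ] (PartialChoice p × ChoosesBelow p n)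
      finiteChoice = induction
        (∃ₜ ((∀ₜ ∀ₜ ⟨ x₁ , x₀ ⟩ₜ ∈ₜ x₂ ⇒ₜ ⟨ x₁ , x₀ ⟩ₜ ∈ₜ ` F) ∧ₜ
             (∀ₜ ∀ₜ ∀ₜ ⟨ x₂ , x₁ ⟩ₜ ∈ₜ x₃ ⇒ₜ ⟨ x₂ , x₀ ⟩ₜ ∈ₜ x₃ ⇒ₜ x₁ ≡ₜ x₀)) ∧ₜ
            (∀ₜ x₀ ∈ₜ x₂ ⇒ₜ (∃ₜ ⟨ x₁ , x₀ ⟩ₜ ∈ₜ ` F) ⇒ₜ (∃ₜ ⟨ x₁ , x₀ ⟩ₜ ∈ₜ x₂)))
        (∅ , ((λ _ _ → ⊥-elim ∘ ∉∅) , (λ _ _ _ → ⊥-elim ∘ ∉∅)) , (λ _ → ⊥-elim ∘ ∉∅))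
        extend
        where
        extend : ∀ n → n ∈ ω → ∃[ p ] (PartialChoice p × ChoosesBelow p n) →
                 ∃[ p ] (PartialChoice p × ChoosesBelow p (succ n))
        extend n n∈ω (p , choice@(p⊆F , p-unique) , below)
          with em (∃ₜ ⟨ ` n , x₀ ⟩ₜ ∈ₜ ` p) | em (∃ₜ ⟨ ` n , x₀ ⟩ₜ ∈ₜ ` F)
        -- `ChoosesBelow` does not confine `p` to indices below `n`, so `p` may already have a value
        -- at `n`; adding another could destroy uniqueness.
        ... | yes n-chosen | _ =
          p , choice , λ j → [ below j , (λ { refl _ → n-chosen }) ]′ ∘ ∈-succ⁻
        ... | no _ | no not-first =
          p , choice , λ j → [ below j , (λ { refl → ⊥-elim ∘ not-first }) ]′ ∘ ∈-succ⁻
        ... | no not-chosen | yes (u , u∈F) =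
          q , ((λ k y → [ p⊆F k y , (λ { (refl , refl) → u∈F }) ]′ ∘ q⁻) , q-unique)
            , λ j → [ (λ j∈n j-first → let y , r = below j j∈n j-first in y , p⊆q r)
                    , (λ { refl _ → u , u∈q }) ]′ ∘ ∈-succ⁻
          where
          φ : Formulaₜ 2
          φ = ⟨ x₀ , x₁ ⟩ₜ ∈ₜ ` p ∨ₜ x₀ ≡ₜ ` n ∧ₜ x₁ ≡ₜ ` u
          q = ｛ ω ⨾ X ∣ φ ｝
          q⁻ : ∀ {k y} → ⟨ k , y ⟩ ∈ q → ⟨ k , y ⟩ ∈ p ⊎ (k ≡ n × y ≡ u)
          q⁻ r = proj₂ (proj₂ (∈-relation⁻ ω X φ r))
          p⊆q : ∀ {k y} → ⟨ k , y ⟩ ∈ p → ⟨ k , y ⟩ ∈ q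
          p⊆q r = let k∈ω , y∈X , _ = F⁻ (p⊆F _ _ r) in ∈-relation⁺ ω X φ k∈ω y∈X (inj₁ r)
          u∈q : ⟨ n , u ⟩ ∈ q
          u∈q = ∈-relation⁺ ω X φ n∈ω (proj₁ (proj₂ (F⁻ u∈F))) (inj₂ (refl , refl))
          q-unique : ∀ k y z → ⟨ k , y ⟩ ∈ q → ⟨ k , z ⟩ ∈ q → y ≡ z
          q-unique k y z r s with q⁻ r | q⁻ s
          ... | inj₁ r′            | inj₁ s′            = p-unique k y z r′ s′
          ... | inj₁ r′            | inj₂ (refl , _)    = ⊥-elim (not-chosen (y , r′))
          ... | inj₂ (refl , _)    | inj₁ s′            = ⊥-elim (not-chosen (z , s′))
          ... | inj₂ (_ , y≡u)     | inj₂ (_ , z≡u)     = trans y≡u (sym z≡u)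

      nextₜ : Formulaₜ (suc (suc n))
      nextₜ = x₁ ∈ₜ x₀ ∧ₜ (∃ₜ ⟨ x₁ , x₀ ⟩ₜ ∈ₜ ` F) ∧ₜ
              (∀ₜ x₀ ∈ₜ x₁ ⇒ₜ x₂ ∈ₜ x₀ ⇒ₜ ¬ₜ (∃ₜ ⟨ x₁ , x₀ ⟩ₜ ∈ₜ ` F))

      Next : V → V → Set ℓ
      Next n k = n ∈ k × IsFirst k × (∀ j → j ∈ k → n ∈ j → ¬ IsFirst j)

      next-unique : ∀ {n k l} → Next n k → Next n l → k ≡ l
      next-unique (n∈k , k-first@(_ , p) , k-next) (n∈l , l-first@(_ , q) , l-next)
        with trichotomy (proj₁ (F⁻ p)) (proj₁ (F⁻ q))
      ... | inj₁ k∈l        = ⊥-elim (l-next _ k∈l n∈k k-first)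
      ... | inj₂ (inj₁ k≡l) = k≡l
      ... | inj₂ (inj₂ l∈k) = ⊥-elim (k-next _ l∈k n∈l l-first)

      φR : Formulaₜ 2
      φR = (∃ₜ ⟨ x₀ , x₂ ⟩ₜ ∈ₜ ` F) ∧ₜ
           (∀ₜ ∀ₜ ⟨ x₁ , x₂ ⟩ₜ ∈ₜ ` F ⇒ₜ nextₜ ⇒ₜ
             ⟨ x₀ , x₃ ⟩ₜ ∈ₜ ` F)

      -- The second condition is vacuous if `y` lies in no class or in the last one. The first then
      -- still forces `z` into some class, so that a sequence never leaves the classes once it has
      -- made a step.
      Successor : V → V → Set ℓ
      Successor y z = (∃[ n ] ⟨ n , z ⟩ ∈ F) × (∀ n k → ⟨ n , y ⟩ ∈ F → Next n k → ⟨ k , z ⟩ ∈ F)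

      R : V
      R = ｛ X ⨾ X ∣ φR ｝

      R⁻ : ∀ {y z} → ⟨ y , z ⟩ ∈ R → Successor y z
      R⁻ p = proj₂ (proj₂ (∈-relation⁻ X X φR p))

      someFirst : ∃[ y ] (y ∈ X × ∃[ n ] ⟨ n , y ⟩ ∈ F)
      someFirst = let y , y∈X , p = E-total ∅ ∅∈ω in y , y∈X , firstIndex ∅∈ω y∈X p

      successor : ∀ y → ∃[ z ] (z ∈ X × Successor y z)
      successor y with em (∃ₜ ∃ₜ ⟨ x₁ , ` y ⟩ₜ ∈ₜ ` F ∧ₜ nextₜ)
      ... | no none =
        let z , z∈X , z-first = someFirst in
        z , z∈X , z-first , λ n k p next → ⊥-elim (none (n , k , p , next))
      ... | yes (n , k , p , next@(_ , (z , q) , _)) =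
        z , proj₁ (proj₂ (F⁻ q)) , (k , q) , λ n′ k′ p′ next′ →
          let n≡n′ = firstIndex-unique p p′ (proj₁ (proj₂ (proj₂ (F⁻ p′)))) (proj₁ (proj₂ (proj₂ (F⁻ p))))
              k≡k′ = next-unique next (subst (λ n → Next n k′) (sym n≡n′) next′)
          in subst (λ k → ⟨ k , z ⟩ ∈ F) k≡k′ q

      R-total : ∀ y → y ∈ X → ∃[ z ] (z ∈ X × ⟨ y , z ⟩ ∈ R)
      R-total y y∈X = let z , z∈X , s = successor y in z , z∈X , ∈-relation⁺ X X φR y∈X z∈X s

      -- A sequence following R visits the classes in the order of their first
      -- indices, omitting at most those that come before the class of its second
      -- element; these finitely many are handled by finiteChoice.
      module _ (g : V) (g-fun : IsFunction g ω X)
               (g-step : ∀ n y z → ⟨ n , y ⟩ ∈ g → ⟨ succ n , z ⟩ ∈ g → ⟨ y , z ⟩ ∈ R) where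

        g-next : ∀ {k y} → ⟨ k , y ⟩ ∈ g → ∃[ z ] (⟨ succ k , z ⟩ ∈ g × Successor y z)
        g-next p =
          let z , q = function-total g-fun (succ∈ω (proj₁ (relation-∈ (proj₁ g-fun) p)))
          in z , q , R⁻ (g-step _ _ _ p q)

        Visited : V → Set ℓ
        Visited i = ∃[ k ] ∃[ y ] (⟨ k , y ⟩ ∈ g × ⟨ i , y ⟩ ∈ F)

        -- The value of `g` at `∅` may lie in no class, so the count begins with the value after it.
        start : ∃[ m ] (m ∈ ω × Visited m)
        start =
          let _ , p = function-total g-fun ∅∈ω
              y , q , (m , r) , _ = g-next p
          in m , proj₁ (F⁻ r) , _ , y , q , r

        -- Here `j` is the greatest first index up to and including `i`. Remembering it lets the
        -- induction pass over indices that are not first, and makes `succ i` the index next to `j`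
        -- as soon as it is first.
        VisitedUpTo : V → Set ℓ
        VisitedUpTo i = ∃[ j ] (j ∈ succ i × Visited j × (∀ l → l ∈ succ i → j ∈ l → ¬ IsFirst l))

        visited⇒visitedUpTo : ∀ {i} → i ∈ ω → Visited i → VisitedUpTo i
        visited⇒visitedUpTo i∈ω v = _ , n∈succ , v , λ l l∈ i∈l →
          ⊥-elim ([ (λ l∈i → n∉n (∈-trans i∈ω i∈l l∈i)) , (λ { refl → n∉n i∈l }) ]′ (∈-succ⁻ l∈))

        visitedUpTo : ∀ i → i ∈ ω → i ∈ proj₁ start ⊎ VisitedUpTo i
        visitedUpTo = induction
          (x₀ ∈ₜ ` m₁ ∨ₜ
            (∃ₜ x₀ ∈ₜ succₜ x₁ ∧ₜ (∃ₜ ∃ₜ ⟨ x₁ , x₀ ⟩ₜ ∈ₜ ` g ∧ₜ ⟨ x₂ , x₀ ⟩ₜ ∈ₜ ` F) ∧ₜ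
                (∀ₜ x₀ ∈ₜ succₜ x₂ ⇒ₜ x₁ ∈ₜ x₀ ⇒ₜ ¬ₜ (∃ₜ ⟨ x₁ , x₀ ⟩ₜ ∈ₜ ` F))))
          (atStart (∅-∈-or-≡ m₁∈ω)) next
          where
          m₁   = proj₁ start
          m₁∈ω = proj₁ (proj₂ start)

          atStart : ∀ {i} → i ∈ m₁ ⊎ i ≡ m₁ → i ∈ m₁ ⊎ VisitedUpTo i
          atStart (inj₁ i∈m)  = inj₁ i∈m
          atStart (inj₂ refl) = inj₂ (visited⇒visitedUpTo m₁∈ω (proj₂ (proj₂ start)))

          next : ∀ i → i ∈ ω → i ∈ m₁ ⊎ VisitedUpTo i → succ i ∈ m₁ ⊎ VisitedUpTo (succ i)
          next i i∈ω (inj₁ i∈m) = atStart (succ-∈-or-≡ m₁∈ω i∈m)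
          next i i∈ω (inj₂ (j , j∈ , v@(k , y , p , q) , none)) with em (∃ₜ ⟨ ` succ i , x₀ ⟩ₜ ∈ₜ ` F)
          ... | no not-first = inj₂ (j , ∈-succ⁺ j∈ , v , λ l →
                  [ none l , (λ { refl _ → not-first }) ]′ ∘ ∈-succ⁻)
          ... | yes first =
            let z , p′ , _ , step = g-next p in
            inj₂ (visited⇒visitedUpTo (succ∈ω i∈ω) (succ k , z , p′ , step j (succ i) q (j∈ , first , none)))

        visited : ∀ i → i ∈ ω → IsFirst i → i ∈ proj₁ start ⊎ Visited i
        visited i i∈ω i-first with visitedUpTo i i∈ω
        ... | inj₁ i∈m = inj₁ i∈m
        ... | inj₂ (j , j∈ , v , none) with ∈-succ⁻ j∈
        ... | inj₁ j∈i  = ⊥-elim (none i n∈succ j∈i i-first)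
        ... | inj₂ refl = inj₂ v

        p : V
        p = proj₁ (finiteChoice (proj₁ start) (proj₁ (proj₂ start)))

        p-choice : PartialChoice p
        p-choice = proj₁ (proj₂ (finiteChoice (proj₁ start) (proj₁ (proj₂ start))))

        p-below : ChoosesBelow p (proj₁ start)
        p-below = proj₂ (proj₂ (finiteChoice (proj₁ start) (proj₁ (proj₂ start))))

        -- One point from each class, and the resulting choice function

        φh : Formulaₜ 2
        φh = ⟨ x₀ , x₁ ⟩ₜ ∈ₜ ` p ∨ₜ
             (¬ₜ (∃ₜ ⟨ x₁ , x₀ ⟩ₜ ∈ₜ ` p)) ∧ₜ ⟨ x₀ , x₁ ⟩ₜ ∈ₜ ` F ∧ₜ
             (∃ₜ ⟨ x₀ , x₂ ⟩ₜ ∈ₜ ` g ∧ₜ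
                 (∀ₜ x₀ ∈ₜ x₁ ⇒ₜ ¬ₜ (∃ₜ ⟨ x₁ , x₀ ⟩ₜ ∈ₜ ` g ∧ₜ ⟨ x₃ , x₀ ⟩ₜ ∈ₜ ` F)))

        -- From a last class `g` may jump back to any class, so a class can be met at several
        -- positions; the least one singles out a point.
        FirstVisit : V → V → V → Set ℓ
        FirstVisit j k y = ⟨ k , y ⟩ ∈ g × (∀ l → l ∈ k → ¬ (∃[ z ] (⟨ l , z ⟩ ∈ g × ⟨ j , z ⟩ ∈ F)))

        h : V
        h = ｛ ω ⨾ X ∣ φh ｝

        -- As `p` may also have values at or beyond the starting index, it takes precedence wherever
        -- it is defined; this keeps the two alternatives exclusive.
        Selected : V → V → Set ℓ
        Selected j y = ⟨ j , y ⟩ ∈ p ⊎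
          ((¬ (∃[ z ] ⟨ j , z ⟩ ∈ p)) × ⟨ j , y ⟩ ∈ F × ∃[ k ] FirstVisit j k y)

        h⁺ : ∀ {j y} → ⟨ j , y ⟩ ∈ F → Selected j y → ⟨ j , y ⟩ ∈ h
        h⁺ q = let j∈ω , y∈X , _ = F⁻ q in ∈-relation⁺ ω X φh j∈ω y∈X

        h⁻ : ∀ {j y} → ⟨ j , y ⟩ ∈ h → Selected j y
        h⁻ q = proj₂ (proj₂ (∈-relation⁻ ω X φh q))

        h⊆F : ∀ {j y} → ⟨ j , y ⟩ ∈ h → ⟨ j , y ⟩ ∈ F
        h⊆F = [ proj₁ p-choice _ _ , proj₁ ∘ proj₂ ]′ ∘ h⁻

        firstVisit-unique : ∀ {j k k′ y y′} → ⟨ j , y ⟩ ∈ F → ⟨ j , y′ ⟩ ∈ F →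
                            FirstVisit j k y → FirstVisit j k′ y′ → y ≡ y′
        firstVisit-unique q q′ (r , none) (r′ , none′)
          with trichotomy (proj₁ (relation-∈ (proj₁ g-fun) r)) (proj₁ (relation-∈ (proj₁ g-fun) r′))
        ... | inj₁ k∈k′        = ⊥-elim (none′ _ k∈k′ (_ , r , q))
        ... | inj₂ (inj₁ refl) = function-unique g-fun r r′
        ... | inj₂ (inj₂ k′∈k) = ⊥-elim (none _ k′∈k (_ , r′ , q′))

        selected-unique : ∀ {j y z} → Selected j y → Selected j z → y ≡ z
        selected-unique (inj₁ q)              (inj₁ r)               = proj₂ p-choice _ _ _ q r
        selected-unique (inj₁ q)              (inj₂ (none , _))      = ⊥-elim (none (_ , q))
        selected-unique (inj₂ (none , _))     (inj₁ r)               = ⊥-elim (none (_ , r))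
        selected-unique (inj₂ (_ , q , _ , v)) (inj₂ (_ , r , _ , v′)) = firstVisit-unique q r v v′

        h-unique : ∀ {j y z} → ⟨ j , y ⟩ ∈ h → ⟨ j , z ⟩ ∈ h → y ≡ z
        h-unique q r = selected-unique (h⁻ q) (h⁻ r)

        firstVisit : ∀ {j} → Visited j → ∃[ y ] (⟨ j , y ⟩ ∈ F × ∃[ k ] FirstVisit j k y)
        firstVisit {j} v@(_ , _ , q , _) =
          let k , _ , (y , r , s) , first =
                least (∃ₜ ⟨ x₁ , x₀ ⟩ₜ ∈ₜ ` g ∧ₜ ⟨ ` j , x₀ ⟩ₜ ∈ₜ ` F)
                      (proj₁ (relation-∈ (proj₁ g-fun) q)) (proj₂ v)
          in y , s , k , r , first

        h-total : ∀ {j} → IsFirst j → ∃[ y ] ⟨ j , y ⟩ ∈ h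
        h-total {j} j-first@(_ , q) = byCases (em (∃ₜ ⟨ ` j , x₀ ⟩ₜ ∈ₜ ` p))
          where
          byCases : Dec (∃[ y ] ⟨ j , y ⟩ ∈ p) → ∃[ y ] ⟨ j , y ⟩ ∈ h
          byCases (yes (y , r)) = y , h⁺ (proj₁ p-choice _ _ r) (inj₁ r)
          byCases (no none)     =
            [ (λ j∈m → ⊥-elim (none (p-below j j∈m j-first)))
            , (λ v → let y , s , visit = firstVisit v in y , h⁺ s (inj₂ (none , s , visit)))
            ]′ (visited j (proj₁ (F⁻ q)) j-first)

        φf : Formulaₜ 2
        φf = ⟨ x₀ , x₁ ⟩ₜ ∈ₜ ` E ∧ₜ (∃ₜ ⟨ x₀ , x₂ ⟩ₜ ∈ₜ ` h)

        f : V
        f = ｛ ω ⨾ X ∣ φf ｝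

        f⁻ : ∀ {n y} → ⟨ n , y ⟩ ∈ f → ⟨ n , y ⟩ ∈ E × ∃[ j ] ⟨ j , y ⟩ ∈ h
        f⁻ q = proj₂ (proj₂ (∈-relation⁻ ω X φf q))

        F⊆E : ∀ {n y} → ⟨ n , y ⟩ ∈ F → ⟨ n , y ⟩ ∈ E
        F⊆E q = proj₁ (proj₂ (proj₂ (F⁻ q)))

        -- The class of index `n` may have a smaller first index `j`. The point that `h` selects at
        -- `j` lies in the same class, hence by coherence in the section at `n`.
        f-total : ∀ n → n ∈ ω → ∃[ y ] ⟨ n , y ⟩ ∈ f
        f-total n n∈ω =
          let z , z∈X , q = E-total n n∈ω
              j , r = firstIndex n∈ω z∈X q
              y , s = h-total (z , r)
              _ , y∈X , _ = F⁻ (h⊆F s)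
          in y , ∈-relation⁺ ω X φf n∈ω y∈X (E-coherent (F⊆E r) q (F⊆E (h⊆F s)) , j , s)

        -- Two points of one section share their class and so their first index, at which `h` has a
        -- single value.
        f-unique : ∀ {n y z} → ⟨ n , y ⟩ ∈ f → ⟨ n , z ⟩ ∈ f → y ≡ z
        f-unique q r =
          let y∈Eₙ , j , s = f⁻ q
              z∈Eₙ , k , t = f⁻ r
              j≡k = firstIndex-unique (h⊆F s) (h⊆F t)
                      (E-coherent z∈Eₙ (F⊆E (h⊆F t)) y∈Eₙ) (E-coherent y∈Eₙ (F⊆E (h⊆F s)) z∈Eₙ)
          in h-unique (subst (λ j → ⟨ j , _ ⟩ ∈ h) j≡k s) t

        choiceAlong : ∃[ f ] (IsFunction f ω X × (∀ {n y} → ⟨ n , y ⟩ ∈ f → ⟨ n , y ⟩ ∈ E))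
        choiceAlong = f , isFunction (relation-isRelation ω X φf) f-total f-unique , proj₁ ∘ f⁻

      coherentChoice : DC ω X →
        ∃[ f ] (IsFunction f ω X × (∀ {n y} → ⟨ n , y ⟩ ∈ f → ⟨ n , y ⟩ ∈ E))
      coherentChoice dc =
        let y , y∈X , _ = someFirst
            _ , _ , r = R-total y y∈X
            g , g-fun , g-step = dc R (relation-isRelation X X φR) (_ , r) R-total
        in choiceAlong g g-fun g-step

    uniformisation-DC : UniformisationOn ω (𝒫 ω) → DC ω X → UniformisationOn ω X
    uniformisation-DC unif dc D D-total =
      let E , E⊆D , E-total , E-coherent = coherentRefinement unif D D-total
          f , f-fun , f⊆E = FirstIndex.coherentChoice E E-total E-coherent dc
      in f , f-fun , E⊆D ∘ f⊆E

theorem2p8 : ∀ {ℓ : Level} {V : Set ℓ} {_∈_ : Rel V ℓ} (zf : ZF V _∈_) →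
    let open Notions zf in
    ∀ (ω ℝ : V) → Isω ω → IsReals ℝ →
    ACω ω ℝ →
    ∀ (X : V) → DC ω X → ACω ω X
theorem2p8 zf ω ℝ isω isReals acℝ X dc =
  uniformisation⇒ACω zf (uniformisation-DC zf isω
    (uniformisation-ℝ⇒𝒫ω zf isReals isω (ACω⇒uniformisation zf acℝ)) dc)
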